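{- For each integer $t\ge 1$ let $L_{\mathrm a}(t)$ be the number of $3\times 3$ magilatin squares with magic sum $t$. Then $\sum_{t>0} L_{\mathrm a}(t)\,x^t$ equals $$\frac{12x^6\,C(x)}{(1+x)(1+x+x^2)(1+x^2)(1-x^3)(1-x^5)(1-x^6)(1-x^7)(1-x^8)},$$ where $$\begin{aligned}C(x)={}&1+3x+7x^2+15x^3+33x^4+65x^5+128x^6+208x^7+316x^8+434x^9+566x^{10}+676x^{11}\\&+784x^{12}+852x^{13}+911x^{14}+936x^{15}+967x^{16}+967x^{17}+1001x^{18}+995x^{19}+1000x^{20}\\&+955x^{21}+893x^{22}+752x^{23}+624x^{24}+456x^{25}+322x^{26}+174x^{27}+79x^{28}.\end{aligned}$$ Moreover, for every integer $t\ge1$, $$L_{\mathrm a}(t)=\tfrac18t^4-3t^3+a_2(t)\,t^2-a_1(t)\,t+a_0(t)-72\,S_7(t),$$ where $S_7(t)=\left\lfloor\frac{t-1}{21}\right\rfloor+\epsilon(t)$ with $\epsilon(t)=1$ if $t\equiv 10,13,16,17,19,20\pmod{21}$ and $\epsilon(t)=0$ otherwise; $a_2(t)=\frac{151}{4}$ if $t\equiv0$; $\frac{135}{4}$ if $t\equiv2,4$; $\frac{63}{2}$ if $t\equiv1,5$; $\frac{71}{2}$ if $t\equiv3\pmod6$; $a_1(t)=\frac{1296}{5}$ if $t\equiv0$; $\frac{1347}{10}$ if $t\equiv1,5$; $\frac{831}{5}$ if $t\equiv2,10$; $\frac{2097}{10}$ if $t\equiv3$; $\frac{876}{5}$ if $t\equiv4,8$;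 $\frac{1251}{5}$ if $t\equiv6$; $\frac{1257}{10}$ if $t\equiv7,11$; $\frac{2187}{10}$ if $t\equiv9\pmod{12}$; and $a_0(t)$ depends only on $t$ modulo $120$ and is given as follows, where in the line for $r$ the six numbers are the values of $a_0$ at $t\equiv r,\ r+20,\ r+40,\ r+60,\ r+80,\ r+100\pmod{120}$, in this order: $r=0$: $876,\ 340,\ 400,\ 840,\ 376,\ 364$; $r=1$: $\frac{4243}{40},\ \frac{21843}{40},\ \frac{3283}{40},\ \frac{5683}{40},\ \frac{20403}{40},\ \frac{4723}{40}$; $r=2$: $\frac{1097}{5},\ \frac{1037}{5},\ \frac{3597}{5},\ \frac{917}{5},\ \frac{1217}{5},\ \frac{3417}{5}$; $r=3$: $\frac{15219}{40},\ \frac{ -461}{40},\ \frac{ -941}{40},\ \frac{16659}{40},\ \frac{ -1901}{40},\ \frac{499}{40}$; $r=4$: $\frac{1604}{5},\ \frac{4164}{5},\ \frac{1484}{5},\ \frac{1784}{5},\ \frac{3984}{5},\ \frac{1664}{5}$; $r=5$: $\frac{1463}{8},\ \frac{1367}{8},\ \frac{4887}{8},\ \frac{1175}{8},\ \frac{1655}{8},\ \frac{4599}{8}$; $r=6$: $\frac{3201}{5},\ \frac{881}{5},\ \frac{821}{5},\ \frac{3381}{5},\ \frac{701}{5},\ \frac{1001}{5}$; $r=7$: $\frac{3091}{40},\ \frac{17811}{40},\ \frac{2131}{40},\ \frac{1651}{40},\ \frac{19251}{40},\ \frac{691}{40}$; $r=8$: $\frac{1448}{5},\ \frac{1388}{5},\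 \frac{3948}{5},\ \frac{1268}{5},\ \frac{1568}{5},\ \frac{3768}{5}$; $r=9$: $\frac{21267}{40},\ \frac{5587}{40},\ \frac{5107}{40},\ \frac{22707}{40},\ \frac{4147}{40},\ \frac{6547}{40}$; $r=10$: $265,\ 705,\ 241,\ 229,\ 741,\ 205$; $r=11$: $\frac{ -1037}{40},\ \frac{1363}{40},\ \frac{16083}{40},\ \frac{403}{40},\ \frac{ -77}{40},\ \frac{17523}{40}$; $r=12$: $\frac{4092}{5},\ \frac{1772}{5},\ \frac{1712}{5},\ \frac{4272}{5},\ \frac{1592}{5},\ \frac{1892}{5}$; $r=13$: $\frac{4819}{40},\ \frac{19539}{40},\ \frac{3859}{40},\ \frac{3379}{40},\ \frac{20979}{40},\ \frac{2419}{40}$; $r=14$: $\frac{809}{5},\ \frac{1109}{5},\ \frac{3309}{5},\ \frac{989}{5},\ \frac{929}{5},\ \frac{3489}{5}$; $r=15$: $\frac{4023}{8},\ \frac{311}{8},\ \frac{791}{8},\ \frac{3735}{8},\ \frac{599}{8},\ \frac{503}{8}$; $r=16$: $\frac{1676}{5},\ \frac{3876}{5},\ \frac{1556}{5},\ \frac{1496}{5},\ \frac{4056}{5},\ \frac{1376}{5}$; $r=17$: $\frac{5011}{40},\ \frac{7411}{40},\ \frac{22131}{40},\ \frac{6451}{40},\ \frac{5971}{40},\ \frac{23571}{40}$; $r=18$: $\frac{3273}{5},\ \frac{593}{5},\ \frac{893}{5},\ \frac{3093}{5},\ \frac{773}{5},\ \frac{713}{5}$; $r=19$: $\frac{787}{40},\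 \frac{18387}{40},\ \frac{ -173}{40},\ \frac{2227}{40},\ \frac{16947}{40},\ \frac{1267}{40}$. The quasipolynomial $L_{\mathrm a}$ has period exactly $840$, and its principal constituent is $\frac18t^4-3t^3+\frac{151}{4}t^2-\frac{9192}{35}t+948$.
   Context: A $3\times3$ magilatin square is a $3\times 3$ matrix of positive integers in which all three row sums and all three column sums are equal (the common value is the magic sum), and in which the three entries of each row are pairwise distinct and the three entries of each column are pairwise distinct (entries in different rows and different columns may be equal). Squares are counted as matrices (not up to symmetry). A function $N$ of $t\in\mathbb Z_{>0}$ is a quasipolynomial if there are a positive integer $p$ and polynomials $N_0,\dots,N_{p-1}$ (the constituents) with $N(t)=N_{t \bmod p}(t)$; the minimal such $p$ is the period, and $N_0$ is the principal constituent. -}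

module Defs where

open import Agda.Builtin.FromNat using (Number; fromNat)
open import Agda.Builtin.FromNeg using (Negative; fromNeg)
open import Data.Unit.Base using (⊤)
open import Data.Bool.Base using (if_then_else_)
open import Data.Fin.Base using (Fin)
open import Data.Integer.Base as ℤ using (ℤ)
import Data.Integer.Literals as ℤLit
open import Data.List.Base using (List; []; _∷_; _++_; map; replicate; length; filter; foldr; upTo; cartesianProductWith)
open import Data.List.Membership.Propositional using (_∈_)
open import Data.List.Membership.Propositional.Properties
  using (∈-map⁺; ∈-upTo⁺; ∈-filter⁺; ∈-filter⁻; ∈-cartesianProductWith⁺)
open import Data.List.Relation.Unary.All using () renaming ([] to []ᴬ)
open import Data.List.Relation.Unary.AllPairs using () renaming ([] to []ᴾ; _∷_ to _∷ᴾ_)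
open import Data.List.Relation.Unary.Any using (here)
import Data.List.Relation.Unary.Unique.Propositional as List
import Data.List.Relation.Unary.Unique.Propositional.Properties as Unique
open import Data.Nat.Base as ℕ using (ℕ; zero; suc; _∸_; _≤_; _<_; NonZero)
open import Data.Nat.DivMod using (_%_; _mod_)
import Data.Nat.Literals as ℕLit
import Data.Nat.Properties as ℕ
open import Data.List.Membership.DecPropositional ℕ._≟_ using (_∈?_)
open import Data.Product.Base using (_×_; _,_; ∃-syntax; proj₂)
open import Data.Rational.Base as ℚ using (ℚ; _/_)
import Data.Rational.Literals as ℚLit
open import Data.Vec.Base using (Vec; []; _∷_; sum; transpose; lookup)
open import Data.Vec.Properties using (∷-injective)
open import Data.Vec.Relation.Unary.All as All using (All; []; _∷_)
open import Data.Vec.Relation.Unary.AllPairs using (allPairs?)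
open import Data.Vec.Relation.Unary.Unique.Propositional using (Unique)
open import Function.Base using (_∘_)
open import Function.Bundles using (_⇔_; mk⇔)
open import Relation.Binary.PropositionalEquality.Core using (_≡_; refl)
open import Relation.Nullary.Decidable.Core using (Dec; does; ¬?; _×-dec_)

private instance
  ℕ-number : Number ℕ
  ℕ-number = ℕLit.number

  ℤ-number : Number ℤ
  ℤ-number = ℤLit.number

  ℤ-negative : Negative ℤ
  ℤ-negative = ℤLit.negative

  ℚ-number : Number ℚ
  ℚ-number = ℚLit.number

  ℚ-negative : Negative ℚ
  ℚ-negative = ℚLit.negative

toℚ : ℕ → ℚ
toℚ n = ℚLit.fromℤ (ℤ.+ n)

------------------------------------------------------------------------
-- Magilatin squares

Matrix₃ : Set
Matrix₃ = Vec (Vec ℕ 3) 3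

IsMagilatinLine : ℕ → Vec ℕ 3 → Set
IsMagilatinLine t v = sum v ≡ t × Unique v

IsMagilatin : ℕ → Matrix₃ → Set
IsMagilatin t M =
    All (All (0 <_)) M
  × All (IsMagilatinLine t) M
  × All (IsMagilatinLine t) (transpose M)

isMagilatin? : ∀ t M → Dec (IsMagilatin t M)
isMagilatin? t M =
        All.all? (All.all? (0 ℕ.<?_)) M
  ×-dec All.all? line? M
  ×-dec All.all? line? (transpose M)
  where
  line? : ∀ v → Dec (IsMagilatinLine t v)
  line? v = sum v ℕ.≟ t ×-dec allPairs? (λ x y → ¬? (x ℕ.≟ y)) v

words : ∀ {A : Set} → List A → ∀ n → List (Vec A n)
words xs zero    = [] ∷ []
words xs (suc n) = cartesianProductWith _∷_ xs (words xs n)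

-- Positive entries summing to t in each row are at most t, so it is
-- enough to search the matrices with entries in {1, …, t}; see
-- ∈-magilatinSquares and magilatinSquares-unique below.
magilatinSquares : ℕ → List Matrix₃
magilatinSquares t =
  filter (isMagilatin? t) (words (words (map suc (upTo t)) 3) 3)

Lₐ : ℕ → ℕ
Lₐ t = length (magilatinSquares t)

private
  ∈-words : ∀ {A : Set} {xs : List A} {n} {v : Vec A n} →
            All (_∈ xs) v → v ∈ words xs n
  ∈-words []       = here refl
  ∈-words (p ∷ ps) = ∈-cartesianProductWith⁺ _∷_ p (∈-words ps)

  words-unique : ∀ {A : Set} {xs : List A} n →
                 List.Unique xs → List.Unique (words xs n)
  words-unique zero    u = []ᴬ ∷ᴾ []ᴾ
  words-unique (suc n) u =
    Unique.cartesianProductWith⁺ _∷_ ∷-injective u (words-unique n u)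

  ∈-range : ∀ {t k} → 0 < k → k ≤ t → k ∈ map suc (upTo t)
  ∈-range {k = suc k} _ k<t = ∈-map⁺ suc (∈-upTo⁺ k<t)

  entries≤sum : ∀ {n} (v : Vec ℕ n) → All (_≤ sum v) v
  entries≤sum []      = []
  entries≤sum (x ∷ v) =
    ℕ.m≤m+n x (sum v) ∷
    All.map (λ y≤ → ℕ.≤-trans y≤ (ℕ.m≤n+m (sum v) x)) (entries≤sum v)

  row∈ : ∀ {t} {v : Vec ℕ 3} → All (0 <_) v × IsMagilatinLine t v →
         v ∈ words (map suc (upTo t)) 3
  row∈ {v = v} (pos , refl , _) =
    ∈-words (All.map (λ (p , q) → ∈-range p q) (All.zip (pos , entries≤sum v)))

∈-magilatinSquares : ∀ t M → M ∈ magilatinSquares t ⇔ IsMagilatin t M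
∈-magilatinSquares t M = mk⇔
  (proj₂ ∘ ∈-filter⁻ (isMagilatin? t) {xs = words (words (map suc (upTo t)) 3) 3})
  (λ m@(pos , rows , _) →
    ∈-filter⁺ (isMagilatin? t) (∈-words (All.map row∈ (All.zip (pos , rows)))) m)

magilatinSquares-unique : ∀ t → List.Unique (magilatinSquares t)
magilatinSquares-unique t =
  Unique.filter⁺ (isMagilatin? t)
    (words-unique 3 (words-unique 3 (Unique.map⁺ ℕ.suc-injective (Unique.upTo⁺ t))))

------------------------------------------------------------------------
-- Polynomials and formal power series

-- Coefficient lists, constant term first.
Polynomial : Set → Set
Polynomial A = List A

eval : Polynomial ℚ → ℚ → ℚ
eval p x = foldr (λ a v → a ℚ.+ x ℚ.* v) 0 p

infixl 6 _+ₚ_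
infixl 7 _*ₚ_

_+ₚ_ : Polynomial ℤ → Polynomial ℤ → Polynomial ℤ
[]      +ₚ q       = q
(a ∷ p) +ₚ []      = a ∷ p
(a ∷ p) +ₚ (b ∷ q) = a ℤ.+ b ∷ p +ₚ q

_*ₚ_ : Polynomial ℤ → Polynomial ℤ → Polynomial ℤ
[]      *ₚ q = []
(a ∷ p) *ₚ q = map (a ℤ.*_) q +ₚ (0 ∷ p *ₚ q)

monomial : ℤ → ℕ → Polynomial ℤ
monomial a n = replicate n 0 ++ a ∷ []

1-X^_ : ℕ → Polynomial ℤ
1-X^ n = monomial 1 0 +ₚ monomial -1 n

PowerSeries : Set
PowerSeries = ℕ → ℤ

toPowerSeries : Polynomial ℤ → PowerSeries
toPowerSeries []      n       = 0
toPowerSeries (a ∷ p) zero    = a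
toPowerSeries (a ∷ p) (suc n) = toPowerSeries p n

infixl 7 _⊛_

_⊛_ : PowerSeries → PowerSeries → PowerSeries
(f ⊛ g) n = foldr ℤ._+_ 0 (map (λ i → f i ℤ.* g (n ∸ i)) (upTo (suc n)))

-- f = N / D in ℤ[[x]].  The normalisation D(0) = 1 makes D invertible there,
-- so that f is determined by D · f = N.
infix 4 _≈_÷_

_≈_÷_ : PowerSeries → Polynomial ℤ → Polynomial ℤ → Set
f ≈ N ÷ D =
  toPowerSeries D 0 ≡ 1 × (∀ n → (toPowerSeries D ⊛ f) n ≡ toPowerSeries N n)

-- The sum of a(t) x^t over t > 0.
generatingFunction : (ℕ → ℕ) → PowerSeries
generatingFunction a zero    = 0
generatingFunction a (suc n) = ℤ.+ a (suc n)

------------------------------------------------------------------------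
-- Quasipolynomials

-- A function on positive integers is given by a function on ℕ whose value at 0
-- is irrelevant.
AreConstituents : (ℕ → ℚ) → (p : ℕ) .{{_ : NonZero p}} → (Fin p → Polynomial ℚ) → Set
AreConstituents f p N = ∀ t → 1 ≤ t → f t ≡ eval (N (t mod p)) (toℚ t)

IsQuasipolynomialModulo : (ℕ → ℚ) → (p : ℕ) .{{_ : NonZero p}} → Set
IsQuasipolynomialModulo f p = ∃[ N ] AreConstituents f p N

IsPeriod : (ℕ → ℚ) → (p : ℕ) .{{_ : NonZero p}} → Set
IsPeriod f p =
    IsQuasipolynomialModulo f p
  × (∀ q .{{_ : NonZero q}} → IsQuasipolynomialModulo f q → p ≤ q)

-- To be used with p the period of f.  A constituent is determined by f and p,
-- since it is prescribed at infinitely many t.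
IsPrincipalConstituent : (ℕ → ℚ) → (p : ℕ) .{{_ : NonZero p}} → Polynomial ℚ → Set
IsPrincipalConstituent f p P =
  ∃[ N ] AreConstituents f p N × N (0 mod p) ≡ P

------------------------------------------------------------------------
-- The generating function of Lₐ

C : Polynomial ℤ
C = 1 ∷ 3 ∷ 7 ∷ 15 ∷ 33 ∷ 65 ∷ 128 ∷ 208 ∷ 316 ∷ 434
  ∷ 566 ∷ 676 ∷ 784 ∷ 852 ∷ 911 ∷ 936 ∷ 967 ∷ 967 ∷ 1001 ∷ 995
  ∷ 1000 ∷ 955 ∷ 893 ∷ 752 ∷ 624 ∷ 456 ∷ 322 ∷ 174 ∷ 79 ∷ []

numerator : Polynomial ℤ
numerator = monomial 12 6 *ₚ C

denominator : Polynomial ℤ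
denominator =
     (1 ∷ 1 ∷ []) *ₚ (1 ∷ 1 ∷ 1 ∷ []) *ₚ (1 ∷ 0 ∷ 1 ∷ [])
  *ₚ 1-X^ 3 *ₚ 1-X^ 5 *ₚ 1-X^ 6 *ₚ 1-X^ 7 *ₚ 1-X^ 8

------------------------------------------------------------------------
-- The coefficients of the quasipolynomial Lₐ

ε : ℕ → ℕ
ε t = if does (t % 21 ∈? 10 ∷ 13 ∷ 16 ∷ 17 ∷ 19 ∷ 20 ∷ []) then 1 else 0

S₇ : ℕ → ℕ
S₇ t = (t ∸ 1) ℕ./ 21 ℕ.+ ε t

-- Values at t ≡ 0, 1, …, 5 (mod 6).
a₂ : ℕ → ℚ
a₂ t = lookup
  (151 / 4 ∷ 63 / 2 ∷ 135 / 4 ∷ 71 / 2 ∷ 135 / 4 ∷ 63 / 2 ∷ [])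
  (t mod 6)

-- Values at t ≡ 0, 1, …, 11 (mod 12).
a₁ : ℕ → ℚ
a₁ t = lookup
  ( 1296 / 5 ∷ 1347 / 10 ∷ 831 / 5 ∷ 2097 / 10
  ∷ 876 / 5 ∷ 1347 / 10 ∷ 1251 / 5 ∷ 1257 / 10
  ∷ 876 / 5 ∷ 2187 / 10 ∷ 831 / 5 ∷ 1257 / 10 ∷ [])
  (t mod 12)

-- Row r, column j (both from 0) is the value at t ≡ r + 20 j (mod 120).
a₀ : ℕ → ℚ
a₀ t = lookup (lookup table (t mod 20)) ((t ℕ./ 20) mod 6)
  where
  table : Vec (Vec ℚ 6) 20
  table =
    ( (876 ∷ 340 ∷ 400 ∷ 840 ∷ 376 ∷ 364 ∷ [])
    ∷ (4243 / 40 ∷ 21843 / 40 ∷ 3283 / 40 ∷ 5683 / 40 ∷ 20403 / 40 ∷ 4723 / 40 ∷ [])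
    ∷ (1097 / 5 ∷ 1037 / 5 ∷ 3597 / 5 ∷ 917 / 5 ∷ 1217 / 5 ∷ 3417 / 5 ∷ [])
    ∷ (15219 / 40 ∷ -461 / 40 ∷ -941 / 40 ∷ 16659 / 40 ∷ -1901 / 40 ∷ 499 / 40 ∷ [])
    ∷ (1604 / 5 ∷ 4164 / 5 ∷ 1484 / 5 ∷ 1784 / 5 ∷ 3984 / 5 ∷ 1664 / 5 ∷ [])
    ∷ (1463 / 8 ∷ 1367 / 8 ∷ 4887 / 8 ∷ 1175 / 8 ∷ 1655 / 8 ∷ 4599 / 8 ∷ [])
    ∷ (3201 / 5 ∷ 881 / 5 ∷ 821 / 5 ∷ 3381 / 5 ∷ 701 / 5 ∷ 1001 / 5 ∷ [])
    ∷ (3091 / 40 ∷ 17811 / 40 ∷ 2131 / 40 ∷ 1651 / 40 ∷ 19251 / 40 ∷ 691 / 40 ∷ [])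
    ∷ (1448 / 5 ∷ 1388 / 5 ∷ 3948 / 5 ∷ 1268 / 5 ∷ 1568 / 5 ∷ 3768 / 5 ∷ [])
    ∷ (21267 / 40 ∷ 5587 / 40 ∷ 5107 / 40 ∷ 22707 / 40 ∷ 4147 / 40 ∷ 6547 / 40 ∷ [])
    ∷ (265 ∷ 705 ∷ 241 ∷ 229 ∷ 741 ∷ 205 ∷ [])
    ∷ (-1037 / 40 ∷ 1363 / 40 ∷ 16083 / 40 ∷ 403 / 40 ∷ -77 / 40 ∷ 17523 / 40 ∷ [])
    ∷ (4092 / 5 ∷ 1772 / 5 ∷ 1712 / 5 ∷ 4272 / 5 ∷ 1592 / 5 ∷ 1892 / 5 ∷ [])
    ∷ (4819 / 40 ∷ 19539 / 40 ∷ 3859 / 40 ∷ 3379 / 40 ∷ 20979 / 40 ∷ 2419 / 40 ∷ [])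
    ∷ (809 / 5 ∷ 1109 / 5 ∷ 3309 / 5 ∷ 989 / 5 ∷ 929 / 5 ∷ 3489 / 5 ∷ [])
    ∷ (4023 / 8 ∷ 311 / 8 ∷ 791 / 8 ∷ 3735 / 8 ∷ 599 / 8 ∷ 503 / 8 ∷ [])
    ∷ (1676 / 5 ∷ 3876 / 5 ∷ 1556 / 5 ∷ 1496 / 5 ∷ 4056 / 5 ∷ 1376 / 5 ∷ [])
    ∷ (5011 / 40 ∷ 7411 / 40 ∷ 22131 / 40 ∷ 6451 / 40 ∷ 5971 / 40 ∷ 23571 / 40 ∷ [])
    ∷ (3273 / 5 ∷ 593 / 5 ∷ 893 / 5 ∷ 3093 / 5 ∷ 773 / 5 ∷ 713 / 5 ∷ [])
    ∷ (787 / 40 ∷ 18387 / 40 ∷ -173 / 40 ∷ 2227 / 40 ∷ 16947 / 40 ∷ 1267 / 40 ∷ [])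
    ∷ [])

principalConstituent : Polynomial ℚ
principalConstituent = 948 ∷ -9192 / 35 ∷ 151 / 4 ∷ -3 ∷ 1 / 8 ∷ []

{-# OPTIONS --safe #-}

-- A positive 3 × 3 matrix is semimagic when four linear equations hold, and
-- magilatin when moreover eighteen differences of entries do not vanish.  The
-- solutions of such a homogeneous system are counted exactly by elimination:
-- the condition f ≠ 0 is treated by deletion–contraction (all solutions minus
-- those with f = 0), and a condition f = 0 by comparing a coordinate i on which
-- f has a positive coefficient with a coordinate j on which it has a negative
-- one.  In each of the cases vᵢ = vⱼ, vᵢ > vⱼ and vᵢ < vⱼ a unimodular
-- substitution leads to a smaller system in positive variables.  In the end
-- only free positive variables remain, and they contribute ∏ x^w / (1 - x^w).
-- The signed sum of these fractions is the stated generating function.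
--
-- The closed formula is a quasipolynomial satisfying the linear recurrence
-- given by the denominator, with the right initial values.  For the period,
-- if L has constituents modulo q then the constituents at 0 and at q modulo 840
-- agree at infinitely many points, hence as polynomials; but the constant
-- term 948 at 0 occurs at no other residue modulo 840.
module Submission where

open import Defs

open import Data.Bool.Base using (Bool; true; false; if_then_else_)
open import Data.Empty using (⊥-elim)
open import Data.Fin using (#_)
open import Data.Fin.Base using (Fin; zero; suc; toℕ; punchIn; punchOut)
import Data.Fin.Properties as Fin
open import Data.Integer.Base as ℤ using (ℤ; +_; -[1+_]; -1ℤ)
import Data.Integer.Properties as ℤ
open import Data.List.Base as List
  using (List; []; _∷_; _++_; length; filter; replicate; foldr; applyUpTo; drop)
import Data.List.Properties as List
open import Data.List.Relation.Unary.All as All using (All; []; _∷_)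
import Data.List.Relation.Unary.All.Properties as All
import Data.List.Relation.Unary.AllPairs as AllPairs
open import Data.List.Relation.Unary.Any using (here)
open import Data.Maybe.Base as Maybe using (Maybe; just; nothing; _>>=_; _<∣>_)
open import Data.Nat.Base as ℕ using (ℕ; zero; suc; _∸_; _≤_; _<_; z≤n; s≤s; NonZero)
open import Data.Nat.DivMod
  using ( _%_; _mod_; m%n<n; m*n%n≡0; n%n≡0; [m+n]%n≡m%n; [m+kn]%n≡m%n
        ; m≡m%n+[m/n]*n; +-distrib-/-∣ˡ )
open import Data.Nat.Divisibility using (divides; ∣⇒≤; m%n≡0⇒n∣m)
open import Data.Nat.Induction using (<-rec)
open import Data.Nat.ListAction using (sum)
import Data.Nat.Properties as ℕ
open import Data.Product.Base using (_×_; _,_; ∃-syntax; proj₁; proj₂)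
open import Data.Rational.Base as ℚ using (ℚ)
open import Data.Rational.Literals using (fromℤ)
import Data.Rational.Properties as ℚ
open import Data.Sum.Base as Sum using (_⊎_; inj₁; inj₂; [_,_])
open import Data.Vec.Base as Vec
  using (Vec; []; _∷_; lookup; updateAt; insertAt; removeAt; tabulate; toList)
open import Function.Base using (_∘_)
open import Function.Bundles using (_⇔_; mk⇔; module Equivalence)
open import Relation.Binary.PropositionalEquality
  using (_≡_; _≢_; _≗_; refl; sym; trans; cong; cong₂; subst; subst₂; ≢-sym; module ≡-Reasoning)
open import Relation.Nullary using (¬_; yes; no)
open import Relation.Nullary.Decidable.Core using (does; ¬?; from-yes; _→-dec_)
open import Relation.Unary using (Decidable)

-- Counting finite sets by duplicate-free enumerations.

module Cardinality where

  open import Data.Integer.Base using (_+_; _-_)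
  open import Data.List.Membership.Propositional using (_∈_)
  open import Data.List.Membership.Propositional.Properties
    using (∈-map⁺; ∈-map⁻; ∈-++⁺ˡ; ∈-++⁺ʳ; ∈-++⁻; ∈-filter⁺; ∈-filter⁻)
  open import Data.List.Membership.Propositional.Properties.WithK using (unique∧set⇒bag)
  open import Data.List.Relation.Binary.BagAndSetEquality using (∼bag⇒↭)
  open import Data.List.Relation.Binary.Permutation.Propositional.Properties using (↭-length)
  import Data.List.Relation.Unary.Unique.Propositional as List
  import Data.List.Relation.Unary.Unique.Propositional.Properties as Unique

  -- The size is an integer, so that differences of counts and signed sums of series can be used
  -- without truncated subtraction.
  record Card {A : Set} (P : A → Set) (n : ℤ) : Set where
    constructor card
    field
      elements : List A
      unique   : List.Unique elements
      sound    : ∀ {x} → x ∈ elements → P x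
      complete : ∀ {x} → P x → x ∈ elements
      size     : + length elements ≡ n

  module _ {A : Set} where

    -- Two duplicate-free lists with the same members are permutations of each other.
    card-injective : ∀ {P : A → Set} {m n} → Card P m → Card P n → m ≡ n
    card-injective (card xs u s c refl) (card ys u′ s′ c′ refl) =
      cong +_ (↭-length (∼bag⇒↭ (unique∧set⇒bag u u′ (mk⇔ (c′ ∘ s) (c ∘ s′)))))

    card-⇔ : ∀ {P Q : A → Set} {n} → (∀ x → P x ⇔ Q x) → Card P n → Card Q n
    card-⇔ P⇔Q (card xs u s c e) =
      card xs u (Equivalence.to (P⇔Q _) ∘ s) (c ∘ Equivalence.from (P⇔Q _)) e

    card-∅ : ∀ {P : A → Set} → (∀ x → ¬ P x) → Card P (+ 0)
    card-∅ ¬P = card [] AllPairs.[] (λ ()) (⊥-elim ∘ ¬P _) refl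

    card-⊎ : ∀ {P Q : A → Set} {m n} → (∀ x → P x → ¬ Q x) →
             Card P m → Card Q n → Card (λ x → P x ⊎ Q x) (m + n)
    card-⊎ disjoint (card xs u s c refl) (card ys u′ s′ c′ refl) = card
      (xs ++ ys)
      (Unique.++⁺ u u′ (λ (p , q) → disjoint _ (s p) (s′ q)))
      (Sum.map s s′ ∘ ∈-++⁻ xs)
      [ ∈-++⁺ˡ ∘ c , ∈-++⁺ʳ xs ∘ c′ ]
      (cong +_ (List.length-++ xs))

    -- The complement is enumerated by filtering. Its size is not computed from the filter: `P` is
    -- the disjoint union of the two parts, and sizes are unique.
    card-∖ : ∀ {P Q : A → Set} {m n} → Decidable Q →
             Card P m → Card (λ x → P x × Q x) n → Card (λ x → P x × ¬ Q x) (m - n)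
    card-∖ {P} {Q} {m} {n} Q? p@(card xs u s c e) pq =
      subst (Card _) (trans (cancel (+ length rest.elements) n) (cong (_- n) parts)) rest
      where
      rest : Card (λ x → P x × ¬ Q x) (+ length (filter (¬? ∘ Q?) xs))
      rest = card (filter (¬? ∘ Q?) xs) (Unique.filter⁺ (¬? ∘ Q?) u)
        (λ x∈ → let (x∈xs , ¬Qx) = ∈-filter⁻ (¬? ∘ Q?) {xs = xs} x∈ in s x∈xs , ¬Qx)
        (λ (Px , ¬Qx) → ∈-filter⁺ (¬? ∘ Q?) (c Px) ¬Qx)
        refl
      module rest = Card rest

      split : ∀ x → ((P x × ¬ Q x) ⊎ (P x × Q x)) ⇔ P x
      split x = mk⇔ [ proj₁ , proj₁ ] λ Px → decide Px (Q? x)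
        where
        decide : P x → _ → (P x × ¬ Q x) ⊎ (P x × Q x)
        decide Px (yes Qx) = inj₂ (Px , Qx)
        decide Px (no ¬Qx) = inj₁ (Px , ¬Qx)

      parts : + length rest.elements + n ≡ m
      parts = card-injective
        (card-⇔ split (card-⊎ (λ _ (_ , ¬Qx) (_ , Qx) → ¬Qx Qx) rest pq)) p

      cancel : ∀ i j → i ≡ (i + j) - j
      cancel i j = begin
        i              ≡⟨ ℤ.+-identityʳ i ⟨
        i + + 0        ≡⟨ cong (λ k → i + k) (ℤ.+-inverseʳ j) ⟨
        i + (j - j)    ≡⟨ ℤ.+-assoc i j (ℤ.- j) ⟨
        (i + j) - j    ∎
        where open ≡-Reasoning

  module _ {A B : Set} where

    card-image : ∀ {P : A → Set} {n} (f : A → B) → (∀ {x y} → f x ≡ f y → x ≡ y) →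
                 Card P n → Card (λ y → ∃[ x ] y ≡ f x × P x) n
    card-image f f-inj (card xs u s c e) = card
      (List.map f xs)
      (Unique.map⁺ f-inj u)
      (λ y∈ → let (x , x∈ , y≡fx) = ∈-map⁻ f y∈ in x , y≡fx , s x∈)
      (λ { (x , refl , Px) → ∈-map⁺ f (c Px) })
      (trans (cong +_ (List.length-map f xs)) e)

open Cardinality

-- Unimodular substitutions on positive vectors.

module Substitution where

  open import Data.Fin.Properties using (_≟_; punchIn-punchOut)
  open import Data.Integer.Base using (_+_; _*_)
  open import Data.Integer.Tactic.RingSolver using (solve-∀)
  open import Data.Vec.Properties
  open import Relation.Binary.Definitions using (tri<; tri≈; tri>)

  infix 7 _∙_

  _∙_ : ∀ {k} → Vec ℤ k → Vec ℕ k → ℤ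
  []      ∙ []      = + 0
  (a ∷ f) ∙ (x ∷ v) = a * + x + f ∙ v

  ∙-updateAtˡ : ∀ {k} (f : Vec ℤ k) (v : Vec ℕ k) i c →
                updateAt f i (_+ c) ∙ v ≡ f ∙ v + c * + lookup v i
  ∙-updateAtˡ (a ∷ f) (x ∷ v) zero c = lemma c a (+ x) (f ∙ v)
    where
    lemma : ∀ c a x r → (a + c) * x + r ≡ a * x + r + c * x
    lemma = solve-∀
  ∙-updateAtˡ (a ∷ f) (x ∷ v) (suc i) c =
    trans (cong (_+_ (a * + x)) (∙-updateAtˡ f v i c)) (sym (ℤ.+-assoc (a * + x) _ _))

  ∙-updateAtʳ : ∀ {k} (f : Vec ℤ k) (v : Vec ℕ k) i c →
                f ∙ updateAt v i (c ℕ.+_) ≡ f ∙ v + lookup f i * + c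
  ∙-updateAtʳ (a ∷ f) (x ∷ v) zero c = lemma (+ c) a (+ x) (f ∙ v)
    where
    lemma : ∀ c a x r → a * (c + x) + r ≡ a * x + r + a * c
    lemma = solve-∀
  ∙-updateAtʳ (a ∷ f) (x ∷ v) (suc i) c =
    trans (cong (_+_ (a * + x)) (∙-updateAtʳ f v i c)) (sym (ℤ.+-assoc (a * + x) _ _))

  ∙-insertAt : ∀ {k} (f : Vec ℤ (suc k)) (v : Vec ℕ k) i c →
               f ∙ insertAt v i c ≡ removeAt f i ∙ v + lookup f i * + c
  ∙-insertAt (a ∷ f) v zero c = ℤ.+-comm (a * + c) (f ∙ v)
  ∙-insertAt (a ∷ f@(_ ∷ _)) (x ∷ v) (suc i) c =
    trans (cong (_+_ (a * + x)) (∙-insertAt f v i c)) (sym (ℤ.+-assoc (a * + x) _ _))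

  -- `pull` is the transpose of `apply`, acting on linear forms. Adjointness is all that is needed
  -- to transport a weight and a list of constraints along the substitution.
  record Substitution (k l : ℕ) : Set where
    field
      apply   : Vec ℕ l → Vec ℕ k
      pull    : Vec ℤ k → Vec ℤ l
      adjoint : ∀ f v → f ∙ apply v ≡ pull f ∙ v

  open Substitution public

  -- Parametrises the positive vectors with vᵢ > vⱼ; dually, the coefficient at `j` gains the one at
  -- `i`.
  raise : ∀ {k} → Fin k → Fin k → Substitution k k
  raise i j = record
    { apply   = λ v → updateAt v i (lookup v j ℕ.+_)
    ; pull    = λ f → updateAt f j (_+ lookup f i)
    ; adjoint = λ f v → trans (∙-updateAtʳ f v i (lookup v j)) (sym (∙-updateAtˡ f v j (lookup f i)))
    }

  -- Parametrises the diagonal vᵢ = vⱼ by the vector without coordinate `i`; `punchOut` is the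
  -- position of `j` after that removal.
  copy : ∀ {k} {i j : Fin (suc k)} → i ≢ j → Substitution (suc k) k
  copy {i = i} i≢j = record
    { apply   = λ v → insertAt v i (lookup v (punchOut i≢j))
    ; pull    = λ f → updateAt (removeAt f i) (punchOut i≢j) (_+ lookup f i)
    ; adjoint = λ f v → trans (∙-insertAt f v i _)
        (sym (∙-updateAtˡ (removeAt f i) v (punchOut i≢j) (lookup f i)))
    }

  Positive : ∀ {k} → Vec ℕ k → Set
  Positive v = ∀ i → 0 < lookup v i

  module _ {k} {i j : Fin k} (i≢j : i ≢ j) where

    raise-i : ∀ v → lookup (apply (raise i j) v) i ≡ lookup v j ℕ.+ lookup v i
    raise-i v = lookup∘updateAt i v

    raise-≢ : ∀ {l} v → l ≢ i → lookup (apply (raise i j) v) l ≡ lookup v l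
    raise-≢ {l} v l≢i = lookup∘updateAt′ l i l≢i v

    private
      lower : Vec ℕ k → Vec ℕ k
      lower v = updateAt v i (_∸ lookup v j)

      lower∘raise : ∀ v → lower (apply (raise i j) v) ≡ v
      lower∘raise v rewrite raise-≢ v (≢-sym i≢j) =
        trans (updateAt-updateAt i v)
              (updateAt-id-local i v (ℕ.m+n∸m≡n (lookup v j) (lookup v i)))

      raise∘lower : ∀ v → lookup v j < lookup v i → apply (raise i j) (lower v) ≡ v
      raise∘lower v j<i rewrite lookup∘updateAt′ j i {_∸ lookup v j} (≢-sym i≢j) v =
        trans (updateAt-updateAt i v)
              (updateAt-id-local i v (ℕ.m+[n∸m]≡n (ℕ.<⇒≤ j<i)))

    raise-injective : ∀ {v w} → apply (raise i j) v ≡ apply (raise i j) w → v ≡ w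
    raise-injective eq = trans (sym (lower∘raise _)) (trans (cong lower eq) (lower∘raise _))

    -- The preimage subtracts vⱼ from vᵢ. The strict inequality makes the truncated subtraction
    -- exact and keeps the new coordinate positive.
    raise-surjective : ∀ v → lookup v j < lookup v i → Positive v →
                       ∃[ w ] v ≡ apply (raise i j) w × Positive w
    raise-surjective v j<i pos = lower v , sym (raise∘lower v j<i) , pos′
      where
      pos′ : Positive (lower v)
      pos′ l with l ≟ i
      ... | yes refl = subst (0 <_) (sym (lookup∘updateAt l v)) (ℕ.m<n⇒0<n∸m j<i)
      ... | no l≢i   = subst (0 <_) (sym (lookup∘updateAt′ l i l≢i v)) (pos l)

    raise-positive : ∀ v → Positive v → Positive (apply (raise i j) v)
    raise-positive v pos l with l ≟ i
    ... | yes refl = subst (0 <_) (sym (raise-i v)) (ℕ.≤-trans (pos l) (ℕ.m≤n+m _ _))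
    ... | no l≢i   = subst (0 <_) (sym (raise-≢ v l≢i)) (pos l)

    raise-< : ∀ v → Positive v → lookup (apply (raise i j) v) j < lookup (apply (raise i j) v) i
    raise-< v pos = subst₂ _<_ (sym (raise-≢ v (≢-sym i≢j))) (sym (raise-i v))
      (ℕ.m<m+n (lookup v j) (pos i))

  module _ {k} {i j : Fin (suc k)} (i≢j : i ≢ j) where

    copy-i : ∀ v → lookup (apply (copy i≢j) v) i ≡ lookup v (punchOut i≢j)
    copy-i v = insertAt-lookup v i _

    copy-≢ : ∀ {l} (i≢l : i ≢ l) v → lookup (apply (copy i≢j) v) l ≡ lookup v (punchOut i≢l)
    copy-≢ i≢l v = trans
      (cong (lookup (apply (copy i≢j) v)) (sym (punchIn-punchOut i≢l)))
      (insertAt-punchIn v i _ (punchOut i≢l))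

    copy-≡ : ∀ v → lookup (apply (copy i≢j) v) i ≡ lookup (apply (copy i≢j) v) j
    copy-≡ v = trans (copy-i v) (sym (copy-≢ i≢j v))

    copy-injective : ∀ {v w} → apply (copy i≢j) v ≡ apply (copy i≢j) w → v ≡ w
    copy-injective {v} {w} eq = trans (sym (removeAt-insertAt v i _))
      (trans (cong (λ u → removeAt u i) eq) (removeAt-insertAt w i _))

    copy-positive : ∀ v → Positive v → Positive (apply (copy i≢j) v)
    copy-positive v pos l with i ≟ l
    ... | yes refl = subst (0 <_) (sym (copy-i v)) (pos _)
    ... | no i≢l   = subst (0 <_) (sym (copy-≢ i≢l v)) (pos _)

    copy-surjective : ∀ v → lookup v i ≡ lookup v j → Positive v →
                      ∃[ w ] v ≡ apply (copy i≢j) w × Positive w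
    copy-surjective v eq pos =
        removeAt v i
      , sym (trans (cong (insertAt (removeAt v i) i) (trans (removeAt-punchOut v i≢j) (sym eq)))
                   (insertAt-removeAt v i))
      , λ l → subst (0 <_) (punch l) (pos (punchIn i l))
      where
      punch : ∀ l → lookup v (punchIn i l) ≡ lookup (removeAt v i) l
      punch l = trans (cong (λ u → lookup u (punchIn i l)) (sym (insertAt-removeAt v i)))
                      (insertAt-punchIn (removeAt v i) i (lookup v i) l)

  -- The three substitutions are injective on positive vectors, and their images are the regions vᵢ
  -- = vⱼ, vᵢ > vⱼ and vᵢ < vⱼ, which partition the positive vectors.
  card-trichotomy :
    ∀ {k} {i j : Fin (suc k)} {R : Vec ℕ (suc k) → Set} {a b c} (i≢j : i ≢ j) →
    Card (λ v → Positive v × R (apply (copy i≢j) v)) a →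
    Card (λ v → Positive v × R (apply (raise i j) v)) b →
    Card (λ v → Positive v × R (apply (raise j i) v)) c →
    Card (λ v → Positive v × R v) (a + (b + c))
  card-trichotomy {i = i} {j} {R} i≢j A B C = card-⇔ (λ v → mk⇔ to from)
    (card-⊎ (λ v x → [ ℕ.<-irrefl (sym (i≡j x)) ∘ j<i , ℕ.<-irrefl (i≡j x) ∘ i<j ])
      (card-image (apply (copy i≢j)) (copy-injective i≢j) A)
      (card-⊎ (λ v x y → ℕ.<-asym (j<i x) (i<j y))
        (card-image (apply (raise i j)) (raise-injective i≢j) B)
        (card-image (apply (raise j i)) (raise-injective j≢i) C)))
    where
    j≢i : j ≢ i
    j≢i = ≢-sym i≢j

    Image : ∀ {l} → Substitution _ l → Vec ℕ _ → Set
    Image φ v = ∃[ w ] v ≡ apply φ w × Positive w × R (apply φ w)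

    i≡j : ∀ {v} → Image (copy i≢j) v → lookup v i ≡ lookup v j
    i≡j (w , refl , _) = copy-≡ i≢j w

    j<i : ∀ {v} → Image (raise i j) v → lookup v j < lookup v i
    j<i (w , refl , pos , _) = raise-< i≢j w pos

    i<j : ∀ {v} → Image (raise j i) v → lookup v i < lookup v j
    i<j (w , refl , pos , _) = raise-< j≢i w pos

    from-image : ∀ {l} (φ : Substitution _ l) {v} →
                 R v → (∃[ w ] v ≡ apply φ w × Positive w) → Image φ v
    from-image φ r (w , refl , pos) = w , refl , pos , r

    to : ∀ {v} → Image (copy i≢j) v ⊎ Image (raise i j) v ⊎ Image (raise j i) v →
         Positive v × R v
    to (inj₁ (w , refl , pos , r))        = copy-positive i≢j w pos , r
    to (inj₂ (inj₁ (w , refl , pos , r))) = raise-positive i≢j w pos , r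
    to (inj₂ (inj₂ (w , refl , pos , r))) = raise-positive j≢i w pos , r

    from : ∀ {v} → Positive v × R v →
           Image (copy i≢j) v ⊎ Image (raise i j) v ⊎ Image (raise j i) v
    from {v} (pos , r) with ℕ.<-cmp (lookup v i) (lookup v j)
    ... | tri< i<j _ _ = inj₂ (inj₂ (from-image (raise j i) r (raise-surjective j≢i v i<j pos)))
    ... | tri≈ _ i≡j _ = inj₁ (from-image (copy i≢j) r (copy-surjective i≢j v i≡j pos))
    ... | tri> _ _ j<i = inj₂ (inj₁ (from-image (raise i j) r (raise-surjective i≢j v j<i pos)))

open Substitution

-- Polynomials acting on formal power series.

module Series where

  open import Data.Integer.Base using (_+_; _*_; -_)
  open import Data.Integer.Tactic.RingSolver using (solve-∀)
  open import Algebra.Bundles using (module AbelianGroup)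
  open import Algebra.Properties.Group (AbelianGroup.group ℤ.+-0-abelianGroup)
    using () renaming (∙-cancelʳ to +-cancelʳ)

  open ≡-Reasoning

  infixl 6 _⊕_
  infixr 7 _·_ _⊙_

  δ 𝟘 : PowerSeries
  δ = toPowerSeries (+ 1 ∷ [])
  𝟘 _ = + 0

  _⊕_ : PowerSeries → PowerSeries → PowerSeries
  (f ⊕ g) n = f n + g n

  _⊙_ : ℤ → PowerSeries → PowerSeries
  (c ⊙ f) n = c * f n

  shift : ℕ → PowerSeries → PowerSeries
  shift zero    f n       = f n
  shift (suc d) f zero    = + 0
  shift (suc d) f (suc n) = shift d f n

  -- Multiplication in Horner form, which suits induction on the coefficient list; `⊛-·` identifies
  -- it with convolution.
  _·_ : Polynomial ℤ → PowerSeries → PowerSeries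
  []      · f = 𝟘
  (a ∷ p) · f = a ⊙ f ⊕ shift 1 (p · f)

  -- A shift by a positive amount reads only strictly earlier coefficients. This drives the
  -- inductions on the index, both for cancellation and for geometric series.
  shift-cong-< : ∀ d {f g : PowerSeries} n → (∀ m → m < n → f m ≡ g m) →
                 shift (suc d) f n ≡ shift (suc d) g n
  shift-cong-< d       zero    eq = refl
  shift-cong-< zero    (suc n) eq = eq n ℕ.≤-refl
  shift-cong-< (suc d) (suc n) eq = shift-cong-< d n (λ m m<n → eq m (ℕ.m≤n⇒m≤1+n m<n))

  shift-cong : ∀ d {f g} → f ≗ g → shift d f ≗ shift d g
  shift-cong zero    eq n       = eq n
  shift-cong (suc d) eq zero    = refl
  shift-cong (suc d) eq (suc n) = shift-cong d eq n

  shift-⊕ : ∀ d f g → shift d (f ⊕ g) ≗ shift d f ⊕ shift d g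
  shift-⊕ zero    f g n       = refl
  shift-⊕ (suc d) f g zero    = refl
  shift-⊕ (suc d) f g (suc n) = shift-⊕ d f g n

  shift-⊙ : ∀ d c f → shift d (c ⊙ f) ≗ c ⊙ shift d f
  shift-⊙ zero    c f n       = refl
  shift-⊙ (suc d) c f zero    = sym (ℤ.*-zeroʳ c)
  shift-⊙ (suc d) c f (suc n) = shift-⊙ d c f n

  shift-1-shift : ∀ d f → shift 1 (shift d f) ≗ shift d (shift 1 f)
  shift-1-shift zero    f n       = refl
  shift-1-shift (suc d) f zero    = refl
  shift-1-shift (suc d) f (suc n) = trans (lemma d f n) (shift-1-shift d f n)
    where
    lemma : ∀ d f → shift (suc d) f ≗ shift 1 (shift d f)
    lemma d f zero    = refl
    lemma d f (suc n) = refl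

  shift-< : ∀ {d n} f → n < d → shift d f n ≡ + 0
  shift-< {suc d} {zero}  f _         = refl
  shift-< {suc d} {suc n} f (s≤s n<d) = shift-< f n<d

  shift-+ : ∀ d f n → shift d f (d ℕ.+ n) ≡ f n
  shift-+ zero    f n = refl
  shift-+ (suc d) f n = shift-+ d f n

  toPowerSeries-shift : ∀ d p → toPowerSeries (replicate d (+ 0) ++ p) ≗ shift d (toPowerSeries p)
  toPowerSeries-shift zero    p n       = refl
  toPowerSeries-shift (suc d) p zero    = refl
  toPowerSeries-shift (suc d) p (suc n) = toPowerSeries-shift d p n

  private
    medial : ∀ a b c d → a + b + (c + d) ≡ a + c + (b + d)
    medial = solve-∀

    distrib : ∀ c a b → c * a + c * b ≡ c * (a + b)
    distrib = solve-∀

  ·-cong-≤ : ∀ p {f g : PowerSeries} n → (∀ m → m ≤ n → f m ≡ g m) → (p · f) n ≡ (p · g) n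
  ·-cong-≤ []      n eq = refl
  ·-cong-≤ (a ∷ p) n eq = cong₂ _+_ (cong (a *_) (eq n ℕ.≤-refl))
    (shift-cong-< 0 n (λ m m<n → ·-cong-≤ p m (λ l l≤m → eq l (ℕ.≤-trans l≤m (ℕ.<⇒≤ m<n)))))

  ·-cong : ∀ p {f g} → f ≗ g → p · f ≗ p · g
  ·-cong p eq n = ·-cong-≤ p n (λ m _ → eq m)

  ·-⊕ : ∀ p f g → p · (f ⊕ g) ≗ p · f ⊕ p · g
  ·-⊕ []      f g n = refl
  ·-⊕ (a ∷ p) f g n = begin
    a * (f n + g n) + shift 1 (p · (f ⊕ g)) n
      ≡⟨ cong (_+_ (a * (f n + g n))) (trans (shift-cong 1 (·-⊕ p f g) n) (shift-⊕ 1 (p · f) (p · g) n)) ⟩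
    a * (f n + g n) + (shift 1 (p · f) n + shift 1 (p · g) n)
      ≡⟨ cong (_+ _) (ℤ.*-distribˡ-+ a (f n) (g n)) ⟩
    a * f n + a * g n + (shift 1 (p · f) n + shift 1 (p · g) n)
      ≡⟨ medial (a * f n) _ _ _ ⟩
    ((a ∷ p) · f ⊕ (a ∷ p) · g) n ∎

  ·-⊙ : ∀ p c f → p · (c ⊙ f) ≗ c ⊙ (p · f)
  ·-⊙ []      c f n = sym (ℤ.*-zeroʳ c)
  ·-⊙ (a ∷ p) c f n = begin
    a * (c * f n) + shift 1 (p · (c ⊙ f)) n
      ≡⟨ cong (_+_ (a * (c * f n))) (trans (shift-cong 1 (·-⊙ p c f) n) (shift-⊙ 1 c (p · f) n)) ⟩
    a * (c * f n) + c * shift 1 (p · f) n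
      ≡⟨ lemma a c (f n) _ ⟩
    c * (a * f n + shift 1 (p · f) n) ∎
    where
    lemma : ∀ a c x y → a * (c * x) + c * y ≡ c * (a * x + y)
    lemma = solve-∀

  ·-𝟘 : ∀ p → p · 𝟘 ≗ 𝟘
  ·-𝟘 p n = ·-⊙ p (+ 0) 𝟘 n

  ·-shift : ∀ p d f → p · shift d f ≗ shift d (p · f)
  ·-shift []      d f n = sym (shift-𝟘 d n)
    where
    shift-𝟘 : ∀ d → shift d 𝟘 ≗ 𝟘
    shift-𝟘 zero    n       = refl
    shift-𝟘 (suc d) zero    = refl
    shift-𝟘 (suc d) (suc n) = shift-𝟘 d n
  ·-shift (a ∷ p) d f n = begin
    a * shift d f n + shift 1 (p · shift d f) n
      ≡⟨ cong₂ _+_ (sym (shift-⊙ d a f n))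
           (trans (shift-cong 1 (·-shift p d f) n) (shift-1-shift d (p · f) n)) ⟩
    shift d (a ⊙ f) n + shift d (shift 1 (p · f)) n
      ≡⟨ shift-⊕ d _ _ n ⟨
    shift d ((a ∷ p) · f) n ∎

  +ₚ-· : ∀ p q f → (p +ₚ q) · f ≗ p · f ⊕ q · f
  +ₚ-· []      q       f n = sym (ℤ.+-identityˡ _)
  +ₚ-· (a ∷ p) []      f n = sym (ℤ.+-identityʳ _)
  +ₚ-· (a ∷ p) (b ∷ q) f n = begin
    (a + b) * f n + shift 1 ((p +ₚ q) · f) n
      ≡⟨ cong₂ _+_ (ℤ.*-distribʳ-+ (f n) a b)
           (trans (shift-cong 1 (+ₚ-· p q f) n) (shift-⊕ 1 (p · f) (q · f) n)) ⟩
    a * f n + b * f n + (shift 1 (p · f) n + shift 1 (q · f) n)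
      ≡⟨ medial (a * f n) _ _ _ ⟩
    ((a ∷ p) · f ⊕ (b ∷ q) · f) n ∎

  map-* : ∀ c p f → List.map (c *_) p · f ≗ c ⊙ (p · f)
  map-* c []      f n = sym (ℤ.*-zeroʳ c)
  map-* c (a ∷ p) f n = begin
    c * a * f n + shift 1 (List.map (c *_) p · f) n
      ≡⟨ cong₂ _+_ (ℤ.*-assoc c a (f n))
           (trans (shift-cong 1 (map-* c p f) n) (shift-⊙ 1 c (p · f) n)) ⟩
    c * (a * f n) + c * shift 1 (p · f) n
      ≡⟨ distrib c _ _ ⟩
    c * (a * f n + shift 1 (p · f) n) ∎

  *ₚ-· : ∀ p q f → (p *ₚ q) · f ≗ p · q · f
  *ₚ-· []      q f n = refl
  *ₚ-· (a ∷ p) q f n = begin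
    (List.map (a *_) q +ₚ (+ 0 ∷ p *ₚ q)) · f $ n
      ≡⟨ +ₚ-· (List.map (a *_) q) (+ 0 ∷ p *ₚ q) f n ⟩
    (List.map (a *_) q · f) n + (+ 0 + shift 1 ((p *ₚ q) · f) n)
      ≡⟨ cong₂ _+_ (map-* a q f n) (trans (ℤ.+-identityˡ _) (shift-cong 1 (*ₚ-· p q f) n)) ⟩
    a * (q · f) n + shift 1 (p · q · f) n ∎
    where
    infix 3 _$_
    _$_ : PowerSeries → ℕ → ℤ
    f $ n = f n

  -- `δ` is the series 1. Applying both sides to it turns laws of the action into laws for
  -- coefficient lists.
  ·-δ : ∀ p → p · δ ≗ toPowerSeries p
  ·-δ []      n       = refl
  ·-δ (a ∷ p) zero    = trans (ℤ.+-identityʳ _) (ℤ.*-identityʳ a)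
  ·-δ (a ∷ p) (suc n) = trans (cong (_+ _) (ℤ.*-zeroʳ a)) (trans (ℤ.+-identityˡ _) (·-δ p n))

  toPowerSeries-* : ∀ p q → toPowerSeries (p *ₚ q) ≗ p · toPowerSeries q
  toPowerSeries-* p q n = begin
    toPowerSeries (p *ₚ q) n ≡⟨ ·-δ (p *ₚ q) n ⟨
    ((p *ₚ q) · δ) n         ≡⟨ *ₚ-· p q δ n ⟩
    (p · q · δ) n            ≡⟨ ·-cong p (·-δ q) n ⟩
    (p · toPowerSeries q) n  ∎

  toPowerSeries-+ : ∀ p q → toPowerSeries (p +ₚ q) ≗ toPowerSeries p ⊕ toPowerSeries q
  toPowerSeries-+ p q n = begin
    toPowerSeries (p +ₚ q) n              ≡⟨ ·-δ (p +ₚ q) n ⟨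
    ((p +ₚ q) · δ) n                      ≡⟨ +ₚ-· p q δ n ⟩
    (p · δ) n + (q · δ) n                 ≡⟨ cong₂ _+_ (·-δ p n) (·-δ q n) ⟩
    toPowerSeries p n + toPowerSeries q n ∎

  toPowerSeries-map : ∀ c p → toPowerSeries (List.map (c *_) p) ≗ c ⊙ toPowerSeries p
  toPowerSeries-map c p n = begin
    toPowerSeries (List.map (c *_) p) n ≡⟨ ·-δ (List.map (c *_) p) n ⟨
    (List.map (c *_) p · δ) n           ≡⟨ map-* c p δ n ⟩
    c * (p · δ) n                       ≡⟨ cong (c *_) (·-δ p n) ⟩
    c * toPowerSeries p n               ∎

  ⊛-· : ∀ p f → toPowerSeries p ⊛ f ≗ p · f
  ⊛-· p f n = trans
    (cong (foldr _+_ (+ 0)) (List.map-upTo (λ i → toPowerSeries p i * f (n ∸ i)) (suc n)))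
    (go p n)
    where
    term : Polynomial ℤ → ℕ → ℕ → ℤ
    term p n i = toPowerSeries p i * f (n ∸ i)

    zeros : ∀ m (g : ℕ → ℤ) → foldr _+_ (+ 0) (applyUpTo (λ i → + 0 * g i) m) ≡ + 0
    zeros zero    g = refl
    zeros (suc m) g = trans (ℤ.+-identityˡ _) (zeros m (g ∘ suc))

    go : ∀ p n → foldr _+_ (+ 0) (applyUpTo (term p n) (suc n)) ≡ (p · f) n
    go []      n       = zeros (suc n) (λ i → f (n ∸ i))
    go (a ∷ p) zero    = refl
    go (a ∷ p) (suc n) = cong (_+_ (a * f (suc n))) (go p n)

  1-X^-· : ∀ d f → (1-X^ suc d) · f ≗ f ⊕ (- + 1) ⊙ shift (suc d) f
  1-X^-· d f n = begin
    (monomial (+ 1) 0 +ₚ monomial (- + 1) (suc d)) · f ≈ n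
      ≡⟨ +ₚ-· (monomial (+ 1) 0) (monomial (- + 1) (suc d)) f n ⟩
    + 1 * f n + shift 1 𝟘 n + (monomial (- + 1) (suc d) · f) n
      ≡⟨ cong₂ _+_ (one n) (monomial-· (- + 1) (suc d) n) ⟩
    f n + - + 1 * shift (suc d) f n ∎
    where
    infix 3 _≈_
    _≈_ : PowerSeries → ℕ → ℤ
    f ≈ n = f n

    one : ∀ n → + 1 * f n + shift 1 𝟘 n ≡ f n
    one zero    = trans (ℤ.+-identityʳ _) (ℤ.*-identityˡ _)
    one (suc n) = trans (ℤ.+-identityʳ _) (ℤ.*-identityˡ _)

    shift-suc : ∀ d f → shift 1 (shift d f) ≗ shift (suc d) f
    shift-suc d f zero    = refl
    shift-suc d f (suc n) = refl

    monomial-· : ∀ c d → monomial c d · f ≗ c ⊙ shift d f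
    monomial-· c zero    zero    = ℤ.+-identityʳ _
    monomial-· c zero    (suc n) = ℤ.+-identityʳ _
    monomial-· c (suc d) n       = trans (ℤ.+-identityˡ _) (trans
      (shift-cong 1 (monomial-· c d) n) (trans (shift-⊙ 1 c (shift d f) n) (cong (c *_) (shift-suc d f n))))

  -- Since the constant coefficient is 1, the n-th coefficient of the product is `f n` plus a
  -- combination of earlier values, so strong induction recovers `f`.
  ·-injective : ∀ p {f g} → (+ 1 ∷ p) · f ≗ (+ 1 ∷ p) · g → f ≗ g
  ·-injective p {f} {g} eq = <-rec (λ n → f n ≡ g n) λ n rec →
    let tail = shift-cong-< 0 n (λ m m<n → ·-cong-≤ p m (λ l l≤m → rec (ℕ.≤-<-trans l≤m m<n))) in
    trans (sym (ℤ.*-identityˡ (f n))) (trans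
      (+-cancelʳ (shift 1 (p · f) n) (+ 1 * f n) (+ 1 * g n)
        (trans (eq n) (cong (_+_ (+ 1 * g n)) (sym tail))))
      (ℤ.*-identityˡ (g n)))

  1-X^-injective : ∀ d {f g} → (1-X^ suc d) · f ≗ (1-X^ suc d) · g → f ≗ g
  1-X^-injective d = ·-injective (monomial (- + 1) d)

  vanishes : Polynomial ℤ → Bool
  vanishes []        = true
  vanishes (+ 0 ∷ p) = vanishes p
  vanishes (_ ∷ p)   = false

  vanishes-sound : ∀ p → vanishes p ≡ true → toPowerSeries p ≗ 𝟘
  vanishes-sound []        _ n       = refl
  vanishes-sound (+ 0 ∷ p) v zero    = refl
  vanishes-sound (+ 0 ∷ p) v (suc n) = vanishes-sound p v n

  infix 4 _≈ᵇ_

  -- Equality up to trailing zeros, as a Boolean, so that identities between long polynomials are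
  -- settled by evaluation.
  _≈ᵇ_ : Polynomial ℤ → Polynomial ℤ → Bool
  p ≈ᵇ q = vanishes (p +ₚ List.map (- + 1 *_) q)

  ≈ᵇ-sound : ∀ p q → (p ≈ᵇ q) ≡ true → toPowerSeries p ≗ toPowerSeries q
  ≈ᵇ-sound p q eq n = begin
    toPowerSeries p n
      ≡⟨ lemma (toPowerSeries p n) (toPowerSeries q n) ⟩
    (toPowerSeries p n + - + 1 * toPowerSeries q n) + toPowerSeries q n
      ≡⟨ cong (λ x → (toPowerSeries p n + x) + toPowerSeries q n) (toPowerSeries-map (- + 1) q n) ⟨
    (toPowerSeries p n + toPowerSeries (List.map (- + 1 *_) q) n) + toPowerSeries q n
      ≡⟨ cong (_+ toPowerSeries q n) (toPowerSeries-+ p (List.map (- + 1 *_) q) n) ⟨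
    toPowerSeries (p +ₚ List.map (- + 1 *_) q) n + toPowerSeries q n
      ≡⟨ cong (_+ toPowerSeries q n) (vanishes-sound (p +ₚ List.map (- + 1 *_) q) eq n) ⟩
    + 0 + toPowerSeries q n
      ≡⟨ ℤ.+-identityˡ _ ⟩
    toPowerSeries q n ∎
    where
    lemma : ∀ x y → x ≡ (x + - + 1 * y) + y
    lemma = solve-∀

  -- An entry d stands for the factor 1 - x^(1+d).
  extend : List ℕ → Polynomial ℤ → Polynomial ℤ
  extend []       p = p
  extend (d ∷ ds) p = (1-X^ suc d) *ₚ extend ds p

  -- Allows a computation over a larger common denominator: the additional factors are cancelled
  -- afterwards, one at a time.
  extend-injective : ∀ ds p q {f} → extend ds p · f ≗ toPowerSeries (extend ds q) → p · f ≗ toPowerSeries q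
  extend-injective []       p q     eq = eq
  extend-injective (d ∷ ds) p q {f} eq = extend-injective ds p q (1-X^-injective d λ n → begin
    ((1-X^ suc d) · extend ds p · f) n             ≡⟨ *ₚ-· (1-X^ suc d) (extend ds p) f n ⟨
    (extend (d ∷ ds) p · f) n                      ≡⟨ eq n ⟩
    toPowerSeries (extend (d ∷ ds) q) n            ≡⟨ toPowerSeries-* (1-X^ suc d) (extend ds q) n ⟩
    ((1-X^ suc d) · toPowerSeries (extend ds q)) n ∎)

  ·-cancel : ∀ D {f g} → toPowerSeries D 0 ≡ + 1 → D · f ≗ D · g → f ≗ g
  ·-cancel (_ ∷ p) refl = ·-injective p

open Series

-- Generating functions of free positive variables and their numerators.

module Cones where

  open import Data.Integer.Base using (_+_; _*_; -_)
  open import Data.Integer.Tactic.RingSolver using (solve-∀)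

  -- The n-th iterate towards the solution G of G = x^(1+d) (g + G), that is, of g x^(1+d) / (1 -
  -- x^(1+d)). Every iteration raises the order of the error, so n iterations determine the
  -- coefficients up to n; `cone` therefore uses n of them at index n.
  geom : ℕ → PowerSeries → ℕ → PowerSeries
  geom d g zero    = 𝟘
  geom d g (suc n) = shift (suc d) (g ⊕ geom d g n)

  -- ∏ x^w / (1 - x^w), where an entry d stands for the weight w = 1+d.
  cone : List ℕ → PowerSeries
  cone []       = δ
  cone (d ∷ ds) n = geom d (cone ds) n n

  geom-stable : ∀ d g m n {t} → t ≤ m → t ≤ n → geom d g m t ≡ geom d g n t
  geom-stable d g zero    zero    _   _   = refl
  geom-stable d g zero    (suc n) z≤n _   = refl
  geom-stable d g (suc m) zero    _   z≤n = refl
  geom-stable d g (suc m) (suc n) {t} t≤m t≤n = shift-cong-< d t λ s s<t →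
    cong (_+_ (g s)) (geom-stable d g m n (ℕ.≤-pred (ℕ.≤-trans s<t t≤m)) (ℕ.≤-pred (ℕ.≤-trans s<t t≤n)))

  cone-∷ : ∀ d ds → cone (d ∷ ds) ≗ shift (suc d) (cone ds ⊕ cone (d ∷ ds))
  cone-∷ d ds zero    = refl
  cone-∷ d ds (suc t) = shift-cong-< d (suc t) λ s s≤t →
    cong (_+_ (cone ds s)) (geom-stable d (cone ds) t s (ℕ.≤-pred s≤t) ℕ.≤-refl)

  weights : ∀ {k} → Vec ℕ k → Vec ℤ k
  weights = Vec.map (λ d → + suc d)

  total : ∀ {k} → Vec ℕ k → Vec ℕ k → ℕ
  total []       []      = 0
  total (d ∷ ds) (x ∷ v) = suc d ℕ.* x ℕ.+ total ds v

  weights-∙ : ∀ {k} (ds v : Vec ℕ k) → weights ds ∙ v ≡ + total ds v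
  weights-∙ []       []      = refl
  weights-∙ (d ∷ ds) (x ∷ v) = cong₂ _+_ (sym (ℤ.pos-* (suc d) x)) (weights-∙ ds v)

  Cone : ∀ {k} → Vec ℕ k → ℕ → Vec ℕ k → Set
  Cone ds t v = Positive v × total ds v ≡ t

  private
    positive-∷ : ∀ {k x} {v : Vec ℕ k} → 0 < x → Positive v → Positive (x ∷ v)
    positive-∷ 0<x pos zero    = 0<x
    positive-∷ 0<x pos (suc i) = pos i

    increment : ∀ {k} → Vec ℕ (suc k) → Vec ℕ (suc k)
    increment (x ∷ v) = suc x ∷ v

    total-increment : ∀ {k} d (ds : Vec ℕ k) v →
                      total (d ∷ ds) (increment v) ≡ suc d ℕ.+ total (d ∷ ds) v
    total-increment d ds (x ∷ v) =
      trans (cong (ℕ._+ total ds v) (ℕ.*-suc (suc d) x)) (ℕ.+-assoc (suc d) (suc d ℕ.* x) _)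

    total-1∷ : ∀ {k} d (ds : Vec ℕ k) v → total (d ∷ ds) (1 ∷ v) ≡ suc d ℕ.+ total ds v
    total-1∷ d ds v = cong (ℕ._+ total ds v) (ℕ.*-identityʳ (suc d))

    -- Either the first coordinate is 1 and is dropped, or it exceeds 1 and is decremented. Both
    -- moves lower the total by `suc d`.
    card-cone-step : ∀ {k} d (ds : Vec ℕ k) (f g : PowerSeries) t →
      (∀ s → Card (Cone ds s) (f s)) → (∀ s → s < t → Card (Cone (d ∷ ds) s) (g s)) →
      Card (Cone (d ∷ ds) t) (shift (suc d) (f ⊕ g) t)
    card-cone-step d ds f g t F G with t ℕ.<? suc d
    ... | yes t<d = subst (Card _) (sym (shift-< (f ⊕ g) t<d)) (card-∅ λ { (x ∷ v) (pos , eq) →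
      ℕ.<⇒≱ t<d (subst (suc d ≤_) eq (ℕ.≤-trans
        (ℕ.m≤m*n (suc d) x {{ℕ.>-nonZero (pos zero)}}) (ℕ.m≤m+n (suc d ℕ.* x) (total ds v)))) })
    ... | no t≮d with s , refl ← ℕ.m≤n⇒∃[o]m+o≡n (ℕ.≮⇒≥ t≮d) =
      subst (Card _) (sym (shift-+ (suc d) (f ⊕ g) s))
      (card-⇔ (λ v → mk⇔ to from) (card-⊎ disjoint
        (card-image (1 ∷_) (λ { refl → refl }) (F s))
        (card-image increment (λ { {_ ∷ _} {_ ∷ _} refl → refl }) (G s (ℕ.m<n+m s (s≤s z≤n))))))
      where
      Image₁ Image₂ : Vec ℕ _ → Set
      Image₁ v = ∃[ u ] v ≡ 1 ∷ u × Cone ds s u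
      Image₂ v = ∃[ u ] v ≡ increment u × Cone (d ∷ ds) s u

      disjoint : ∀ v → Image₁ v → ¬ Image₂ v
      disjoint v (u , refl , _) (_ ∷ _ , refl , pos , _) = ℕ.<-irrefl refl (pos zero)

      to : ∀ {v} → Image₁ v ⊎ Image₂ v → Cone (d ∷ ds) (suc d ℕ.+ s) v
      to (inj₁ (u , refl , pos , refl)) = positive-∷ (s≤s z≤n) pos , total-1∷ d ds u
      to (inj₂ (u@(_ ∷ _) , refl , pos , refl)) =
        positive-∷ (s≤s z≤n) (pos ∘ suc) , total-increment d ds u

      from : ∀ {v} → Cone (d ∷ ds) (suc d ℕ.+ s) v → Image₁ v ⊎ Image₂ v
      from {0 ∷ v}           (pos , eq) with () ← pos zero
      from {1 ∷ v}           (pos , eq) = inj₁ (v , refl , pos ∘ suc ,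
        ℕ.+-cancelˡ-≡ (suc d) _ _ (trans (sym (total-1∷ d ds v)) eq))
      from {suc (suc x) ∷ v} (pos , eq) = inj₂ (suc x ∷ v , refl , positive-∷ (s≤s z≤n) (pos ∘ suc) ,
        ℕ.+-cancelˡ-≡ (suc d) _ _ (trans (sym (total-increment d ds (suc x ∷ v))) eq))

  card-cone : ∀ {k} (ds : Vec ℕ k) t → Card (Cone ds t) (cone (toList ds) t)
  card-cone []       zero    = card ([] ∷ []) (All.[] AllPairs.∷ AllPairs.[])
    (λ { {[]} _ → (λ ()) , refl }) (λ { {[]} _ → here refl }) refl
  card-cone []       (suc t) = card-∅ λ { [] (_ , ()) }
  card-cone (d ∷ ds) t       = go t t ℕ.≤-refl
    where
    go : ∀ n t → t ≤ n → Card (Cone (d ∷ ds) t) (geom d (cone (toList ds)) n t)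
    go zero    zero z≤n = card-cone-step d ds (cone (toList ds)) 𝟘 0 (card-cone ds) (λ _ ())
    go (suc n) t    t≤n = card-cone-step d ds _ _ t (card-cone ds)
      (λ s s<t → go n s (ℕ.≤-pred (ℕ.≤-trans s<t t≤n)))

  Combination : Set
  Combination = List (ℤ × List ℕ)

  ⟦_⟧ : Combination → PowerSeries
  ⟦ [] ⟧           = 𝟘
  ⟦ (c , ds) ∷ C ⟧ = c ⊙ cone ds ⊕ ⟦ C ⟧

  ⟦++⟧ : ∀ C D → ⟦ C ++ D ⟧ ≗ ⟦ C ⟧ ⊕ ⟦ D ⟧
  ⟦++⟧ []             D n = sym (ℤ.+-identityˡ _)
  ⟦++⟧ ((c , ds) ∷ C) D n =
    trans (cong (_+_ (c * cone ds n)) (⟦++⟧ C D n)) (sym (ℤ.+-assoc (c * cone ds n) _ _))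

  negate : Combination → Combination
  negate = List.map (λ (c , ds) → - c , ds)

  ⟦negate⟧ : ∀ C n → ⟦ negate C ⟧ n ≡ - ⟦ C ⟧ n
  ⟦negate⟧ []             n = refl
  ⟦negate⟧ ((c , ds) ∷ C) n = trans (cong (_+_ (- c * cone ds n)) (⟦negate⟧ C n)) (lemma c _ _)
    where
    lemma : ∀ c x y → - c * x + - y ≡ - (c * x + y)
    lemma = solve-∀

  insert : ℤ → List ℕ → Combination → Combination
  insert c ds [] = (c , ds) ∷ []
  insert c ds ((c′ , ds′) ∷ C) with List.≡-dec ℕ._≟_ ds ds′
  ... | yes _ = (c + c′ , ds′) ∷ C
  ... | no _  = (c′ , ds′) ∷ insert c ds C

  -- Equal weight lists are merged before numerators are formed, so that each list is expanded only
  -- once.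
  collect : Combination → Combination
  collect []             = []
  collect ((c , ds) ∷ C) = insert c ds (collect C)

  ⟦insert⟧ : ∀ c ds C → ⟦ insert c ds C ⟧ ≗ c ⊙ cone ds ⊕ ⟦ C ⟧
  ⟦insert⟧ c ds []               n = refl
  ⟦insert⟧ c ds ((c′ , ds′) ∷ C) n with List.≡-dec ℕ._≟_ ds ds′
  ... | yes refl = lemma c c′ (cone ds n) (⟦ C ⟧ n)
    where
    lemma : ∀ c c′ x y → (c + c′) * x + y ≡ c * x + (c′ * x + y)
    lemma = solve-∀
  ... | no _ = trans (cong (_+_ (c′ * cone ds′ n)) (⟦insert⟧ c ds C n))
    (lemma c c′ (cone ds n) (cone ds′ n) (⟦ C ⟧ n))
    where
    lemma : ∀ c c′ x x′ y → c′ * x′ + (c * x + y) ≡ c * x + (c′ * x′ + y)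
    lemma = solve-∀

  ⟦collect⟧ : ∀ C → ⟦ collect C ⟧ ≗ ⟦ C ⟧
  ⟦collect⟧ []             n = refl
  ⟦collect⟧ ((c , ds) ∷ C) n =
    trans (⟦insert⟧ c ds (collect C) n) (cong (_+_ (c * cone ds n)) (⟦collect⟧ C n))

  -- The quotient q of p by 1 - x^d, where window holds the last d
  -- coefficients of q; it is exact when the final window vanishes.
  divide : (window p : Polynomial ℤ) → Maybe (Polynomial ℤ)
  divide []       p       = nothing
  divide (w ∷ ws) []      = if vanishes (w ∷ ws) then just [] else nothing
  divide (w ∷ ws) (a ∷ p) = Maybe.map (a + w ∷_) (divide (ws ++ a + w ∷ []) p)

  -- For a window of d zeros this reads q = p + x^d q, hence (1 - x^d) q = p. General windows occur
  -- because each step drops the oldest entry and appends the new coefficient of q.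
  divide-sound : ∀ window p {q} → divide window p ≡ just q →
                 ∀ n → toPowerSeries q n ≡ toPowerSeries p n + toPowerSeries (window ++ q) n
  divide-sound (w ∷ ws) [] e n with vanishes (w ∷ ws) in v
  divide-sound (w ∷ ws) [] refl n | true = sym (trans (ℤ.+-identityˡ _)
    (trans (cong (λ r → toPowerSeries r n) (List.++-identityʳ (w ∷ ws))) (vanishes-sound (w ∷ ws) v n)))
  divide-sound (w ∷ ws) (a ∷ p) e n with divide (ws ++ a + w ∷ []) p in d
  divide-sound (w ∷ ws) (a ∷ p) refl zero    | just q = refl
  divide-sound (w ∷ ws) (a ∷ p) refl (suc n) | just q = trans
    (divide-sound (ws ++ a + w ∷ []) p d n)
    (cong (λ r → toPowerSeries p n + toPowerSeries r n) (List.++-assoc ws (a + w ∷ []) q))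

  module Numerator (D : Polynomial ℤ) where

    -- Over a fixed denominator `D` every cone becomes a polynomial, obtained by dividing `D`
    -- successively by the factors 1 - x^w and shifting by w; the result is `nothing` when a
    -- division is not exact.
    cone-numerator : List ℕ → Maybe (Polynomial ℤ)
    cone-numerator []       = just D
    cone-numerator (d ∷ ds) = cone-numerator ds >>= λ p →
      Maybe.map (replicate (suc d) (+ 0) ++_) (divide (replicate (suc d) (+ 0)) p)

    combination-numerator : Combination → Maybe (Polynomial ℤ)
    combination-numerator []             = just []
    combination-numerator ((c , ds) ∷ C) = cone-numerator ds >>= λ p →
      Maybe.map (List.map (c *_) p +ₚ_) (combination-numerator C)

    cone-numerator-sound : ∀ ds {p} → cone-numerator ds ≡ just p → D · cone ds ≗ toPowerSeries p
    cone-numerator-sound []       refl = ·-δ D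
    cone-numerator-sound (d ∷ ds) e with cone-numerator ds in eq
    ... | just p with divide (replicate (suc d) (+ 0)) p in step
    cone-numerator-sound (d ∷ ds) refl | just p | just q =
      -- Both series solve H = x^(1+d) (P + H), and multiplication by 1 - x^(1+d) shows that this
      -- equation has only one solution.
      1-X^-injective d λ n → trans (fixpoint F F-fix n) (sym (fixpoint Q Q-fix n))
      where
      P F Q : PowerSeries
      P = toPowerSeries p
      F = D · cone (d ∷ ds)
      Q = toPowerSeries (replicate (suc d) (+ 0) ++ q)

      fixpoint : ∀ H → H ≗ shift (suc d) (P ⊕ H) → (1-X^ suc d) · H ≗ shift (suc d) P
      fixpoint H fix n = trans (1-X^-· d H n)
        (trans (cong (_+ _) (trans (fix n) (shift-⊕ (suc d) P H n))) (lemma (shift (suc d) P n) _))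
        where
        lemma : ∀ x y → x + y + - + 1 * y ≡ x
        lemma = solve-∀

      F-fix : F ≗ shift (suc d) (P ⊕ F)
      F-fix n = begin
        F n                                                ≡⟨ ·-cong D (cone-∷ d ds) n ⟩
        (D · shift (suc d) (cone ds ⊕ cone (d ∷ ds))) n    ≡⟨ ·-shift D (suc d) _ n ⟩
        shift (suc d) (D · (cone ds ⊕ cone (d ∷ ds))) n
          ≡⟨ shift-cong (suc d) (·-⊕ D (cone ds) (cone (d ∷ ds))) n ⟩
        shift (suc d) (D · cone ds ⊕ F) n
          ≡⟨ shift-cong (suc d) (λ m → cong (_+ F m) (cone-numerator-sound ds eq m)) n ⟩
        shift (suc d) (P ⊕ F) n                            ∎
        where open ≡-Reasoning

      Q-fix : Q ≗ shift (suc d) (P ⊕ Q)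
      Q-fix n = trans (toPowerSeries-shift (suc d) q n)
        (shift-cong (suc d) (divide-sound (replicate (suc d) (+ 0)) p step) n)

    combination-numerator-sound : ∀ C {p} → combination-numerator C ≡ just p → D · ⟦ C ⟧ ≗ toPowerSeries p
    combination-numerator-sound []             refl n = ·-𝟘 D n
    combination-numerator-sound ((c , ds) ∷ C) e    n with cone-numerator ds in p-eq
    ... | just p with combination-numerator C in q-eq
    combination-numerator-sound ((c , ds) ∷ C) refl n | just p | just q = begin
      (D · (c ⊙ cone ds ⊕ ⟦ C ⟧)) n                           ≡⟨ ·-⊕ D (c ⊙ cone ds) ⟦ C ⟧ n ⟩
      (D · c ⊙ cone ds) n + (D · ⟦ C ⟧) n                     ≡⟨ cong (_+ _) (·-⊙ D c (cone ds) n) ⟩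
      c * (D · cone ds) n + (D · ⟦ C ⟧) n
        ≡⟨ cong₂ (λ x y → c * x + y) (cone-numerator-sound ds p-eq n) (combination-numerator-sound C q-eq n) ⟩
      c * toPowerSeries p n + toPowerSeries q n
        ≡⟨ cong (_+ _) (toPowerSeries-map c p n) ⟨
      toPowerSeries (List.map (c *_) p) n + toPowerSeries q n
        ≡⟨ toPowerSeries-+ (List.map (c *_) p) q n ⟨
      toPowerSeries (List.map (c *_) p +ₚ q) n                ∎
      where open ≡-Reasoning

open Cones

-- Counting positive solutions of linear equations and disequations.

module Elimination where

  open import Data.Integer.Base using (_+_; _*_; -_)
  open import Data.Integer.Tactic.RingSolver using (solve-∀)

  data Constraint (k : ℕ) : Set where
    vanishing nonvanishing : Vec ℤ k → Constraint k

  Holds : ∀ {k} → Vec ℕ k → Constraint k → Set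
  Holds v (vanishing f)    = f ∙ v ≡ + 0
  Holds v (nonvanishing f) = f ∙ v ≢ + 0

  Solution : ∀ {k} → Vec ℤ k → List (Constraint k) → ℕ → Vec ℕ k → Set
  Solution w gs t v = w ∙ v ≡ + t × All (Holds v) gs

  CountedBy : ∀ {k} → Vec ℤ k → List (Constraint k) → PowerSeries → Set
  CountedBy w gs f = ∀ t → Card (λ v → Positive v × Solution w gs t v) (f t)

  module _ {k l} (φ : Substitution k l) where

    pullᶜ : Constraint k → Constraint l
    pullᶜ (vanishing f)    = vanishing (pull φ f)
    pullᶜ (nonvanishing f) = nonvanishing (pull φ f)

    holds-pull : ∀ {v} g → Holds v (pullᶜ g) ⇔ Holds (apply φ v) g
    holds-pull {v} (vanishing f)    = mk⇔ (trans (adjoint φ f v)) (trans (sym (adjoint φ f v)))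
    holds-pull {v} (nonvanishing f) = mk⇔ (_∘ trans (sym (adjoint φ f v))) (_∘ trans (adjoint φ f v))

    card-pull : ∀ {w gs t n} →
      Card (λ v → Positive v × Solution (pull φ w) (List.map pullᶜ gs) t v) n →
      Card (λ v → Positive v × Solution w gs t (apply φ v)) n
    card-pull {w} = card-⇔ λ v → mk⇔
      (λ (pos , eq , hs) →
          pos , trans (adjoint φ w v) eq , All.map (Equivalence.to (holds-pull _)) (All.map⁻ hs))
      (λ (pos , eq , hs) →
          pos , trans (sym (adjoint φ w v)) eq , All.map⁺ (All.map (Equivalence.from (holds-pull _)) hs))

  -- A constraint on such a form has the same truth value at all positive vectors, so it can be
  -- discarded or it refutes the system. The test below finds the forms whose nonzero coefficients
  -- all have the same sign.
  Definite : ∀ {k} → Vec ℤ k → Set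
  Definite f = (∀ v → f ∙ v ≡ + 0) ⊎ (∀ v → Positive v → f ∙ v ≢ + 0)

  nonnegative? : ∀ {k} (f : Vec ℤ k) →
    Maybe ((∀ v → f ∙ v ≡ + 0) ⊎ (∀ v → Positive v → + 0 ℤ.< f ∙ v))
  nonnegative? []              = just (inj₁ λ { [] → refl })
  nonnegative? (-[1+ _ ] ∷ f)  = nothing
  nonnegative? (+ zero ∷ f)    = nonnegative? f >>= λ
    { (inj₁ eq) → just (inj₁ λ { (x ∷ v) → trans (ℤ.+-identityˡ _) (eq v) })
    ; (inj₂ lt) → just (inj₂ λ { (x ∷ v) pos →
        subst (+ 0 ℤ.<_) (sym (ℤ.+-identityˡ _)) (lt v (pos ∘ suc)) })
    }
  nonnegative? (+ (suc a) ∷ f) = nonnegative? f >>= λ r → just (inj₂ λ { (x ∷ v) pos →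
    ℤ.+-mono-<-≤ (head x (pos zero)) (tail r v (pos ∘ suc)) })
    where
    head : ∀ x → 0 ℕ.< x → + 0 ℤ.< + suc a * + x
    head (suc x) _ = ℤ.+<+ (ℕ.s≤s ℕ.z≤n)

    tail : (∀ v → f ∙ v ≡ + 0) ⊎ (∀ v → Positive v → + 0 ℤ.< f ∙ v) →
           ∀ v → Positive v → + 0 ℤ.≤ f ∙ v
    tail (inj₁ eq) v _   = ℤ.≤-reflexive (sym (eq v))
    tail (inj₂ lt) v pos = ℤ.<⇒≤ (lt v pos)

  neg-∙ : ∀ {k} (f : Vec ℤ k) v → Vec.map -_ f ∙ v ≡ - (f ∙ v)
  neg-∙ []      []      = refl
  neg-∙ (a ∷ f) (x ∷ v) = trans (cong (_+_ (- a * + x)) (neg-∙ f v)) (lemma a (+ x) _)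
    where
    lemma : ∀ a x r → - a * x + - r ≡ - (a * x + r)
    lemma = solve-∀

  definite? : ∀ {k} (f : Vec ℤ k) → Maybe (Definite f)
  definite? f = Maybe.map from⁺ (nonnegative? f) <∣> Maybe.map from⁻ (nonnegative? (Vec.map -_ f))
    where
    from⁺ : _ → Definite f
    from⁺ (inj₁ eq) = inj₁ eq
    from⁺ (inj₂ lt) = inj₂ λ v pos eq → ℤ.<-irrefl (sym eq) (lt v pos)

    from⁻ : _ → Definite f
    from⁻ (inj₁ eq) = inj₁ λ v → trans (sym (ℤ.neg-involutive _)) (cong -_ (trans (sym (neg-∙ f v)) (eq v)))
    from⁻ (inj₂ lt) = inj₂ λ v pos eq →
      ℤ.<-irrefl (sym (trans (neg-∙ f v) (cong -_ eq))) (lt v pos)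

  weights? : ∀ {k} (w : Vec ℤ k) → Maybe (∃[ ds ] w ≡ weights ds)
  weights? []              = just ([] , refl)
  weights? (+ (suc d) ∷ w) = weights? w >>= λ (ds , eq) → just (d ∷ ds , cong (_ ∷_) eq)
  weights? (_ ∷ w)         = nothing

  argmax : ∀ {k} → Vec ℤ (suc k) → ℤ × Fin (suc k)
  argmax (a ∷ [])        = a , zero
  argmax (a ∷ f@(_ ∷ _)) with argmax f
  ... | b , i = if a ℤ.≤ᵇ b then (b , suc i) else (a , zero)

  Result : ∀ {k} → Vec ℤ k → List (Constraint k) → Set
  Result w gs = ∃[ C ] CountedBy w gs ⟦ C ⟧

  module _ {k} (w : Vec ℤ k) where

    unconstrained : ∀ {ds} → w ≡ weights ds → CountedBy w [] ⟦ (+ 1 , toList ds) ∷ [] ⟧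
    unconstrained {ds} refl t = subst (Card _) (sym (trans (ℤ.+-identityʳ _) (ℤ.*-identityˡ _)))
      (card-⇔ (λ v → mk⇔ (λ (pos , eq) → pos , trans (weights-∙ ds v) (cong +_ eq) , [])
                         (λ (pos , eq , _) → pos , ℤ.+-injective (trans (sym (weights-∙ ds v)) eq)))
              (card-cone ds t))

    redundant : ∀ {g gs f} → (∀ v → Positive v → Holds v g) → CountedBy w gs f → CountedBy w (g ∷ gs) f
    redundant h c t = card-⇔ (λ v → mk⇔
      (λ (pos , eq , hs) → pos , eq , h v pos ∷ hs)
      (λ { (pos , eq , _ ∷ hs) → pos , eq , hs })) (c t)

    inconsistent : ∀ {g gs} → (∀ v → Positive v → ¬ Holds v g) → CountedBy w (g ∷ gs) ⟦ [] ⟧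
    inconsistent ¬h t = card-∅ λ { v (pos , _ , h ∷ _) → ¬h v pos h }

    deletion-contraction : ∀ {f gs} → Result w gs → Result w (vanishing f ∷ gs) →
                           Result w (nonvanishing f ∷ gs)
    deletion-contraction {f} {gs} (C , c) (D , d) = C ++ negate D , λ t →
      subst (Card _) (sym (trans (⟦++⟧ C (negate D) t) (cong (_+_ (⟦ C ⟧ t)) (⟦negate⟧ D t))))
        (card-⇔ (λ v → mk⇔ (λ ((pos , eq , hs) , h) → pos , eq , h ∷ hs)
                           (λ { (pos , eq , h ∷ hs) → (pos , eq , hs) , h }))
          (card-∖ (λ v → f ∙ v ℤ.≟ + 0) (c t)
            (card-⇔ (λ v → mk⇔ (λ { (pos , eq , h ∷ hs) → (pos , eq , hs) , h })
                               (λ ((pos , eq , hs) , h) → pos , eq , h ∷ hs)) (d t))))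

  -- `recurse` takes the substitution as an argument because the weight and every constraint must be
  -- pulled back along each of the three.
  trichotomy : ∀ {k} {i j : Fin (suc k)} {w gs} (i≢j : i ≢ j) →
    (∀ {l} (φ : Substitution (suc k) l) → Maybe (Result (pull φ w) (List.map (pullᶜ φ) gs))) →
    Maybe (Result w gs)
  trichotomy {i = i} {j} {w} {gs} i≢j recurse =
    recurse (copy i≢j) >>= λ (A , a) →
    recurse (raise i j) >>= λ (B , b) →
    recurse (raise j i) >>= λ (C , c) →
    just (A ++ B ++ C , λ t → subst (Card _)
      (sym (trans (⟦++⟧ A (B ++ C) t) (cong (_+_ (⟦ A ⟧ t)) (⟦++⟧ B C t))))
      (card-trichotomy i≢j (card-pull (copy i≢j) {w} {gs} (a t))
        (card-pull (raise i j) {w} {gs} (b t)) (card-pull (raise j i) {w} {gs} (c t))))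

  -- The first argument bounds the depth.  Comparing coordinates with extreme
  -- coefficients matters: other choices need not terminate.
  eliminate : ℕ → ∀ {k} (w : Vec ℤ k) (gs : List (Constraint k)) → Maybe (Result w gs)
  eliminate zero    w gs = nothing
  eliminate (suc n) w [] = weights? w >>= λ (ds , eq) → just ((+ 1 , toList ds) ∷ [] , unconstrained w eq)
  eliminate (suc n) w (vanishing f ∷ gs) with definite? f
  ... | just (inj₁ eq) = eliminate n w gs >>= λ (C , c) → just (C , redundant w (λ v _ → eq v) c)
  ... | just (inj₂ ne) = just ([] , inconsistent w ne)
  eliminate (suc n) {zero}  w (vanishing f ∷ gs) | nothing = nothing
  eliminate (suc n) {suc k} w (vanishing f ∷ gs) | nothing
    with proj₂ (argmax f) Fin.≟ proj₂ (argmax (Vec.map -_ f))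
  ... | yes _   = nothing
  -- As `f` is not definite, the two positions carry its largest, positive coefficient and its
  -- smallest, negative one. The equation is kept and pulled back too: in each branch one of these
  -- coefficients is replaced by their sum, or both merge into it.
  ... | no i≢j  = trichotomy i≢j λ φ → eliminate n (pull φ w) (List.map (pullᶜ φ) (vanishing f ∷ gs))
  eliminate (suc n) w (nonvanishing f ∷ gs) with definite? f
  ... | just (inj₁ eq) = just ([] , inconsistent w (λ v _ ne → ne (eq v)))
  ... | just (inj₂ ne) = eliminate n w gs >>= λ (C , c) → just (C , redundant w ne c)
  ... | nothing        = eliminate n w gs >>= λ c → eliminate n w (vanishing f ∷ gs) >>= λ d →
                         just (deletion-contraction w c d)

  module _ (ds : List ℕ) (D N : Polynomial ℤ) {k} (w : Vec ℤ k) (gs : List (Constraint k)) where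

    open Numerator (extend ds D)

    hasNumerator : Maybe (Result w gs) → Bool
    hasNumerator nothing        = false
    hasNumerator (just (C , _)) with combination-numerator (collect C)
    ... | nothing = false
    ... | just p  = p ≈ᵇ extend ds N

    -- The numerator is computed over `extend ds D`, which has room for denominators of individual
    -- cones that do not divide `D`; the factors from `ds` are then cancelled.
    rational : ∀ r → hasNumerator r ≡ true → ∃[ f ] CountedBy w gs f × D · f ≗ toPowerSeries N
    rational (just (C , counted)) eq with combination-numerator (collect C) in p-eq
    ... | just p = ⟦ C ⟧ , counted , extend-injective ds D N λ n →
      trans (·-cong (extend ds D) (λ m → sym (⟦collect⟧ C m)) n)
        (trans (combination-numerator-sound (collect C) p-eq n) (≈ᵇ-sound p (extend ds N) eq n))

open Elimination

-- Integer linear forms as equations and disequations between natural numbers.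

module Forms where

  open import Data.Integer.Base using (_+_; _*_; _-_)
  open import Data.Integer.Tactic.RingSolver using (solve-∀)

  form : ∀ {k} → List (Fin k) → List (Fin k) → Vec ℤ k
  form []       []       = Vec.replicate _ (+ 0)
  form []       (n ∷ ns) = updateAt (form [] ns) n (_+ -1ℤ)
  form (p ∷ ps) ns       = updateAt (form ps ns) p (_+ + 1)

  sumAt : ∀ {k} → List (Fin k) → Vec ℕ k → ℕ
  sumAt is v = sum (List.map (lookup v) is)

  form-∙ : ∀ {k} ps ns (v : Vec ℕ k) → form ps ns ∙ v ≡ + sumAt ps v - + sumAt ns v
  form-∙ []       []       v = zeros v
    where
    zeros : ∀ {k} (v : Vec ℕ k) → Vec.replicate k (+ 0) ∙ v ≡ + 0
    zeros []      = refl
    zeros (x ∷ v) = trans (ℤ.+-identityˡ _) (zeros v)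
  form-∙ []       (n ∷ ns) v = begin
    form [] (n ∷ ns) ∙ v                         ≡⟨ ∙-updateAtˡ (form [] ns) v n -1ℤ ⟩
    form [] ns ∙ v + -1ℤ * + lookup v n        ≡⟨ cong (_+ _) (form-∙ [] ns v) ⟩
    + 0 - + sumAt ns v + -1ℤ * + lookup v n    ≡⟨ lemma (+ sumAt ns v) (+ lookup v n) ⟩
    + 0 - + sumAt (n ∷ ns) v                     ∎
    where
    open ≡-Reasoning
    lemma : ∀ s x → + 0 - s + -1ℤ * x ≡ + 0 - (x + s)
    lemma = solve-∀
  form-∙ (p ∷ ps) ns       v = begin
    form (p ∷ ps) ns ∙ v                                  ≡⟨ ∙-updateAtˡ (form ps ns) v p (+ 1) ⟩
    form ps ns ∙ v + + 1 * + lookup v p                   ≡⟨ cong (_+ _) (form-∙ ps ns v) ⟩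
    + sumAt ps v - + sumAt ns v + + 1 * + lookup v p
      ≡⟨ lemma (+ sumAt ps v) (+ sumAt ns v) (+ lookup v p) ⟩
    + sumAt (p ∷ ps) v - + sumAt ns v                     ∎
    where
    open ≡-Reasoning
    lemma : ∀ s r x → s - r + + 1 * x ≡ (x + s) - r
    lemma = solve-∀

  form≡0 : ∀ {k} ps ns (v : Vec ℕ k) → (form ps ns ∙ v ≡ + 0) ⇔ (sumAt ps v ≡ sumAt ns v)
  form≡0 ps ns v = mk⇔
    (λ eq → ℤ.+-injective (ℤ.i-j≡0⇒i≡j _ _ (trans (sym (form-∙ ps ns v)) eq)))
    (λ eq → trans (form-∙ ps ns v) (ℤ.i≡j⇒i-j≡0 (cong +_ eq)))

  equation : ∀ {k} → List (Fin k) × List (Fin k) → Constraint k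
  equation (ps , ns) = vanishing (form ps ns)

  disequation : ∀ {k} → Fin k × Fin k → Constraint k
  disequation (i , j) = nonvanishing (form (i ∷ []) (j ∷ []))

  module _ {k} (v : Vec ℕ k) where

    Equal : List (Fin k) × List (Fin k) → Set
    Equal (ps , ns) = sumAt ps v ≡ sumAt ns v

    Distinct : Fin k × Fin k → Set
    Distinct (i , j) = lookup v i ≢ lookup v j

    holds-equal : ∀ e → Holds v (equation e) ⇔ Equal e
    holds-equal (ps , ns) = form≡0 ps ns v

    holds-distinct : ∀ p → Holds v (disequation p) ⇔ Distinct p
    holds-distinct (i , j) = mk⇔
      (λ h eq → h (E.from (cong (ℕ._+ 0) eq)))
      (λ ne eq → ne (trans (sym (ℕ.+-identityʳ _)) (trans (E.to eq) (ℕ.+-identityʳ _))))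
      where module E = Equivalence (form≡0 (i ∷ []) (j ∷ []) v)

    solution⇔ : ∀ is es ds t →
      Solution (form is []) (List.map equation es ++ List.map disequation ds) t v ⇔
      (sumAt is v ≡ t × All Equal es × All Distinct ds)
    solution⇔ is es ds t = mk⇔
      (λ (s , hs) →
          ℤ.+-injective (trans (sym weight) s)
        , All.map (λ {e} → Equivalence.to (holds-equal e)) (All.map⁻ (All.++⁻ˡ (List.map equation es) hs))
        , All.map (λ {d} → Equivalence.to (holds-distinct d)) (All.map⁻ (All.++⁻ʳ (List.map equation es) hs)))
      (λ (s , eqs , nes) →
          trans weight (cong +_ s)
        , All.++⁺ (All.map⁺ (All.map (λ {e} → Equivalence.from (holds-equal e)) eqs))
                  (All.map⁺ (All.map (λ {d} → Equivalence.from (holds-distinct d)) nes)))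
      where
      weight : form is [] ∙ v ≡ + sumAt is v
      weight = trans (form-∙ is [] v) (ℤ.+-identityʳ _)

open Forms

-- Magilatin squares as solutions of a linear system.

module Magilatin where

  open import Data.Nat.Base using (_+_)
  open import Data.Nat.Tactic.RingSolver using (solve-∀)
  open import Data.Vec.Relation.Unary.All using ([]; _∷_)
  import Data.Vec.Relation.Unary.All.Properties as Vec
  open import Data.Vec.Relation.Unary.AllPairs using ([]; _∷_)

  magicSum : Vec ℤ 9
  magicSum = form (# 0 ∷ # 1 ∷ # 2 ∷ []) []

  -- For a matrix with rows (a b c), (d e f), (g h i): a + d = i + h,
  -- a + c = e + h, a + g = e + f and a + b = i + f.
  equations : List (List (Fin 9) × List (Fin 9))
  equations =
      (# 0 ∷ # 3 ∷ [] , # 8 ∷ # 7 ∷ [])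
    ∷ (# 0 ∷ # 2 ∷ [] , # 4 ∷ # 7 ∷ [])
    ∷ (# 0 ∷ # 6 ∷ [] , # 4 ∷ # 5 ∷ [])
    ∷ (# 0 ∷ # 1 ∷ [] , # 8 ∷ # 5 ∷ [])
    ∷ []

  disequations : List (Fin 9 × Fin 9)
  disequations =
      (# 0 , # 1) ∷ (# 0 , # 2) ∷ (# 1 , # 2)
    ∷ (# 3 , # 4) ∷ (# 3 , # 5) ∷ (# 4 , # 5)
    ∷ (# 6 , # 7) ∷ (# 6 , # 8) ∷ (# 7 , # 8)
    ∷ (# 0 , # 3) ∷ (# 0 , # 6) ∷ (# 3 , # 6)
    ∷ (# 1 , # 4) ∷ (# 1 , # 7) ∷ (# 4 , # 7)
    ∷ (# 2 , # 5) ∷ (# 2 , # 8) ∷ (# 5 , # 8)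
    ∷ []

  constraints : List (Constraint 9)
  constraints = List.map equation equations ++ List.map disequation disequations

  -- Elimination cuts some cones along rays of weight 9, 10, 11 and 14, so the
  -- individual fractions have these further factors in their denominators.
  extra : List ℕ
  extra = 8 ∷ 9 ∷ 10 ∷ 13 ∷ []

  count : PowerSeries
  count t = + Lₐ t

  matrix : Vec ℕ 9 → Matrix₃
  matrix (a ∷ b ∷ c ∷ d ∷ e ∷ f ∷ g ∷ h ∷ i ∷ []) =
    (a ∷ b ∷ c ∷ []) ∷ (d ∷ e ∷ f ∷ []) ∷ (g ∷ h ∷ i ∷ []) ∷ []

  matrix-injective : ∀ {v w} → matrix v ≡ matrix w → v ≡ w
  matrix-injective {_ ∷ _ ∷ _ ∷ _ ∷ _ ∷ _ ∷ _ ∷ _ ∷ _ ∷ []}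
                   {_ ∷ _ ∷ _ ∷ _ ∷ _ ∷ _ ∷ _ ∷ _ ∷ _ ∷ []} refl = refl

  IsSemimagic : ℕ → Vec ℕ 9 → Set
  IsSemimagic t (a ∷ b ∷ c ∷ d ∷ e ∷ f ∷ g ∷ h ∷ i ∷ []) =
      (line a b c ≡ t × line d e f ≡ t × line g h i ≡ t)
    × (line a d g ≡ t × line b e h ≡ t × line c f i ≡ t)
    where
    line : ℕ → ℕ → ℕ → ℕ
    line x y z = x + (y + (z + 0))

  -- Each equation compares a row and a column without their common entry: row 3 with column 1, row
  -- 1 with column 2, row 2 with column 1, row 1 with column 3. This leaves two classes of lines
  -- with equal sums, which the total of all entries links.
  semimagic⇔ : ∀ t v → (sumAt (# 0 ∷ # 1 ∷ # 2 ∷ []) v ≡ t × All (Equal v) equations) ⇔ IsSemimagic t v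
  semimagic⇔ t v@(a ∷ b ∷ c ∷ d ∷ e ∷ f ∷ g ∷ h ∷ i ∷ []) = mk⇔ to from
    where
    from : IsSemimagic t v → sumAt (# 0 ∷ # 1 ∷ # 2 ∷ []) v ≡ t × All (Equal v) equations
    from ((r₁ , r₂ , r₃) , (c₁ , c₂ , c₃)) =
        r₁
      , cancel a d i h g (trans (l₁ a d g) c₁) (trans (l₂ i h g) r₃)
      ∷ cancel a c e h b (trans (l₃ a c b) r₁) (trans (l₄ e h b) c₂)
      ∷ cancel a g e f d (trans (l₃ a g d) c₁) (trans (l₄ e f d) r₂)
      ∷ cancel a b i f c (trans (l₁ a b c) r₁) (trans (l₂ i f c) c₃)
      ∷ []
      where
      cancel : ∀ p q r s x → p + (q + 0) + x ≡ t → r + (s + 0) + x ≡ t → p + (q + 0) ≡ r + (s + 0)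
      cancel p q r s x eq eq′ = ℕ.+-cancelʳ-≡ x _ _ (trans eq (sym eq′))

      l₁ : ∀ p q x → p + (q + 0) + x ≡ p + (q + (x + 0))
      l₁ = solve-∀
      l₂ : ∀ p q x → p + (q + 0) + x ≡ x + (q + (p + 0))
      l₂ = solve-∀
      l₃ : ∀ p q x → p + (q + 0) + x ≡ p + (x + (q + 0))
      l₃ = solve-∀
      l₄ : ∀ p q x → p + (q + 0) + x ≡ x + (p + (q + 0))
      l₄ = solve-∀

    to : sumAt (# 0 ∷ # 1 ∷ # 2 ∷ []) v ≡ t × All (Equal v) equations → IsSemimagic t v
    to (r₁ , a+d≡i+h ∷ a+c≡e+h ∷ a+g≡e+f ∷ a+b≡i+f ∷ []) =
      (r₁ , trans r₂≡c₁ c₁ , trans r₃≡c₁ c₁) , (c₁ , c₂ , c₃)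
      where
      c₂ : b + (e + (h + 0)) ≡ t
      c₂ = trans (cong (_+_ b) (sym a+c≡e+h)) (trans (l b a c) r₁)
        where
        l : ∀ b a c → b + (a + (c + 0)) ≡ a + (b + (c + 0))
        l = solve-∀

      c₃ : c + (f + (i + 0)) ≡ t
      c₃ = trans (l c f i) (trans (cong (_+_ c) (sym a+b≡i+f)) (trans (l′ c a b) r₁))
        where
        l : ∀ c f i → c + (f + (i + 0)) ≡ c + (i + (f + 0))
        l = solve-∀
        l′ : ∀ c a b → c + (a + (b + 0)) ≡ a + (b + (c + 0))
        l′ = solve-∀

      r₂≡c₁ : d + (e + (f + 0)) ≡ a + (d + (g + 0))
      r₂≡c₁ = trans (cong (_+_ d) (sym a+g≡e+f)) (l d a g)
        where
        l : ∀ d a g → d + (a + (g + 0)) ≡ a + (d + (g + 0))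
        l = solve-∀

      r₃≡c₁ : g + (h + (i + 0)) ≡ a + (d + (g + 0))
      r₃≡c₁ = trans (l g h i) (trans (cong (_+_ g) (sym a+d≡i+h)) (l′ g a d))
        where
        l : ∀ g h i → g + (h + (i + 0)) ≡ g + (i + (h + 0))
        l = solve-∀
        l′ : ∀ g a d → g + (a + (d + 0)) ≡ a + (d + (g + 0))
        l′ = solve-∀

      -- The rows and the columns have the same total: t + 2 c₁ = 2 t + c₁.
      c₁ : a + (d + (g + 0)) ≡ t
      c₁ = ℕ.+-cancelˡ-≡ (t + (a + (d + (g + 0)))) _ t (begin
        t + (a + (d + (g + 0))) + (a + (d + (g + 0)))
          ≡⟨ cong₂ _+_ (cong₂ _+_ r₁ r₂≡c₁) r₃≡c₁ ⟨
        a + (b + (c + 0)) + (d + (e + (f + 0))) + (g + (h + (i + 0)))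
          ≡⟨ transposed a b c d e f g h i ⟩
        b + (e + (h + 0)) + (a + (d + (g + 0))) + (c + (f + (i + 0)))
          ≡⟨ cong₂ (λ x y → x + (a + (d + (g + 0))) + y) c₂ c₃ ⟩
        t + (a + (d + (g + 0))) + t ∎)
        where
        open ≡-Reasoning
        transposed : ∀ a b c d e f g h i →
          a + (b + (c + 0)) + (d + (e + (f + 0))) + (g + (h + (i + 0))) ≡
          b + (e + (h + 0)) + (a + (d + (g + 0))) + (c + (f + (i + 0)))
        transposed = solve-∀

  IsMagilatin⇔ : ∀ t v → (Positive v × Solution magicSum constraints t v) ⇔ IsMagilatin t (matrix v)
  IsMagilatin⇔ t v = mk⇔
    (λ (pos , sol) → let (s , es , ds) = Equivalence.to sol⇔ sol in
      assemble v pos (Equivalence.to (semimagic⇔ t v) (s , es)) ds)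
    (λ mag → let (pos , semi , ds) = disassemble v mag; (s , es) = Equivalence.from (semimagic⇔ t v) semi in
      pos , Equivalence.from sol⇔ (s , es , ds))
    where
    sol⇔ = solution⇔ v (# 0 ∷ # 1 ∷ # 2 ∷ []) equations disequations t

    assemble : ∀ v → Positive v → IsSemimagic t v → All (Distinct v) disequations → IsMagilatin t (matrix v)
    assemble (a ∷ b ∷ c ∷ d ∷ e ∷ f ∷ g ∷ h ∷ i ∷ []) pos ((r₁ , r₂ , r₃) , (c₁ , c₂ , c₃))
      ( ab ∷ ac ∷ bc ∷ de ∷ df ∷ ef ∷ gh ∷ gi ∷ hi
      ∷ ad ∷ ag ∷ dg ∷ be ∷ bh ∷ eh ∷ cf ∷ ci ∷ fi ∷ []) =
        ( (pos (# 0) ∷ pos (# 1) ∷ pos (# 2) ∷ [])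
        ∷ (pos (# 3) ∷ pos (# 4) ∷ pos (# 5) ∷ [])
        ∷ (pos (# 6) ∷ pos (# 7) ∷ pos (# 8) ∷ []) ∷ [])
      , ( (r₁ , (ab ∷ ac ∷ []) ∷ (bc ∷ []) ∷ [] ∷ [])
        ∷ (r₂ , (de ∷ df ∷ []) ∷ (ef ∷ []) ∷ [] ∷ [])
        ∷ (r₃ , (gh ∷ gi ∷ []) ∷ (hi ∷ []) ∷ [] ∷ []) ∷ [])
      , ( (c₁ , (ad ∷ ag ∷ []) ∷ (dg ∷ []) ∷ [] ∷ [])
        ∷ (c₂ , (be ∷ bh ∷ []) ∷ (eh ∷ []) ∷ [] ∷ [])
        ∷ (c₃ , (cf ∷ ci ∷ []) ∷ (fi ∷ []) ∷ [] ∷ []) ∷ [])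

    disassemble : ∀ v → IsMagilatin t (matrix v) →
                  Positive v × IsSemimagic t v × All (Distinct v) disequations
    disassemble (_ ∷ _ ∷ _ ∷ _ ∷ _ ∷ _ ∷ _ ∷ _ ∷ _ ∷ [])
      ( ((a+ ∷ b+ ∷ c+ ∷ []) ∷ (d+ ∷ e+ ∷ f+ ∷ []) ∷ (g+ ∷ h+ ∷ i+ ∷ []) ∷ [])
      , ( (r₁ , (ab ∷ ac ∷ []) ∷ (bc ∷ []) ∷ [] ∷ [])
        ∷ (r₂ , (de ∷ df ∷ []) ∷ (ef ∷ []) ∷ [] ∷ [])
        ∷ (r₃ , (gh ∷ gi ∷ []) ∷ (hi ∷ []) ∷ [] ∷ []) ∷ [])
      , ( (c₁ , (ad ∷ ag ∷ []) ∷ (dg ∷ []) ∷ [] ∷ [])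
        ∷ (c₂ , (be ∷ bh ∷ []) ∷ (eh ∷ []) ∷ [] ∷ [])
        ∷ (c₃ , (cf ∷ ci ∷ []) ∷ (fi ∷ []) ∷ [] ∷ []) ∷ [])) =
        Vec.lookup⁺ {P = 0 <_} (a+ ∷ b+ ∷ c+ ∷ d+ ∷ e+ ∷ f+ ∷ g+ ∷ h+ ∷ i+ ∷ [])
      , ((r₁ , r₂ , r₃) , (c₁ , c₂ , c₃))
      , ( ab ∷ ac ∷ bc ∷ de ∷ df ∷ ef ∷ gh ∷ gi ∷ hi
        ∷ ad ∷ ag ∷ dg ∷ be ∷ bh ∷ eh ∷ cf ∷ ci ∷ fi ∷ [])

  -- The image of the solutions under `matrix` and the list `magilatinSquares t` enumerate the same
  -- set, so their sizes agree.
  count≗ : ∀ {f} → CountedBy magicSum constraints f → f ≗ count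
  count≗ counted t = card-injective
    (card-⇔ (λ M → mk⇔ (λ { (v , refl , sol) → Equivalence.to (IsMagilatin⇔ t v) sol }) (unfold M))
      (card-image matrix matrix-injective (counted t)))
    (card (magilatinSquares t) (magilatinSquares-unique t)
      (Equivalence.to (∈-magilatinSquares t _)) (Equivalence.from (∈-magilatinSquares t _)) refl)
    where
    unfold : ∀ M → IsMagilatin t M → ∃[ v ] M ≡ matrix v × Positive v × Solution magicSum constraints t v
    unfold ((a ∷ b ∷ c ∷ []) ∷ (d ∷ e ∷ f ∷ []) ∷ (g ∷ h ∷ i ∷ []) ∷ []) mag =
      let v = a ∷ b ∷ c ∷ d ∷ e ∷ f ∷ g ∷ h ∷ i ∷ [] in v , refl , Equivalence.from (IsMagilatin⇔ t v) mag

  denominator-·-count : denominator · count ≗ toPowerSeries numerator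
  denominator-·-count = conclude
    -- Here `refl` runs the whole elimination and compares the resulting numerator with the stated
    -- one; a depth of 100 suffices.
    (rational extra denominator numerator magicSum constraints (eliminate 100 magicSum constraints) refl)
    where
    -- Matching on a variable: projections from the closed term above would make
    -- the type checker run the elimination again.
    conclude : ∃[ f ] CountedBy magicSum constraints f × denominator · f ≗ toPowerSeries numerator →
               denominator · count ≗ toPowerSeries numerator
    conclude (f , counted , eq) n =
      trans (·-cong denominator (λ m → sym (count≗ counted m)) n) (eq n)

open Magilatin

-- Quasipolynomials through finite differences.

module Quasi where

  open import Data.Integer.Base using (_+_; _*_; _-_)
  open import Data.Integer.Tactic.RingSolver using (solve-∀)

  open ≡-Reasoning

  ∇ : ℕ → PowerSeries → PowerSeries
  ∇ m f n = f (m ℕ.+ n) - f n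

  -- On every residue class modulo m, f is a polynomial of degree less than k.
  Quasi : ℕ → ℕ → PowerSeries → Set
  Quasi m zero    f = f ≗ 𝟘
  Quasi m (suc k) f = Quasi m k (∇ m f)

  id⊙_ : PowerSeries → PowerSeries
  (id⊙ f) n = + n * f n

  module _ (m : ℕ) where

    quasi-cong : ∀ k {f g} → f ≗ g → Quasi m k f → Quasi m k g
    quasi-cong zero    eq q n = trans (sym (eq n)) (q n)
    quasi-cong (suc k) eq     = quasi-cong k (λ n → cong₂ _-_ (eq (m ℕ.+ n)) (eq n))

    quasi-⊕ : ∀ k {f g} → Quasi m k f → Quasi m k g → Quasi m k (f ⊕ g)
    quasi-⊕ zero    q r n         = cong₂ _+_ (q n) (r n)
    quasi-⊕ (suc k) {f} {g} q r   = quasi-cong k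
      (λ n → lemma (f (m ℕ.+ n)) (g (m ℕ.+ n)) (f n) (g n)) (quasi-⊕ k q r)
      where
      lemma : ∀ x y z w → (x - z) + (y - w) ≡ (x + y) - (z + w)
      lemma = solve-∀

    quasi-⊙ : ∀ k c {f} → Quasi m k f → Quasi m k (c ⊙ f)
    quasi-⊙ zero    c q n     = trans (cong (c *_) (q n)) (ℤ.*-zeroʳ c)
    quasi-⊙ (suc k) c {f} q   = quasi-cong k (λ n → lemma c (f (m ℕ.+ n)) (f n)) (quasi-⊙ k c q)
      where
      lemma : ∀ c x y → c * (x - y) ≡ c * x - c * y
      lemma = solve-∀

    quasi-translate : ∀ k {f} → Quasi m k f → Quasi m k (λ n → f (m ℕ.+ n))
    quasi-translate zero    q n = q (m ℕ.+ n)
    quasi-translate (suc k) q   = quasi-translate k q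

    -- The discrete product rule: the difference of n f(n) is n times the difference of f, plus m
    -- f(m + n).
    quasi-id⊙ : ∀ k f → Quasi m k f → Quasi m (suc k) (id⊙ f)
    quasi-id⊙ zero    f q n = trans (cong₂ (λ x y → + (m ℕ.+ n) * x - + n * y) (q (m ℕ.+ n)) (q n))
                                  (lemma (+ (m ℕ.+ n)) (+ n))
      where
      lemma : ∀ x y → x * + 0 - y * + 0 ≡ + 0
      lemma = solve-∀
    quasi-id⊙ (suc k) f q   = quasi-cong (suc k)
      (λ n → lemma (+ m) (+ n) (f (m ℕ.+ n)) (f n))
      (quasi-⊕ (suc k) {id⊙ (∇ m f)} {+ m ⊙ f⁺} (quasi-id⊙ k (∇ m f) q)
        (quasi-⊙ (suc k) (+ m) {f⁺} (quasi-translate (suc k) {f} q)))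
      where
      f⁺ : PowerSeries
      f⁺ n = f (m ℕ.+ n)
      lemma : ∀ m n x y → n * (x - y) + m * x ≡ (m + n) * x - n * y
      lemma = solve-∀

    quasi-periodic : ∀ {f} → (∀ n → f (m ℕ.+ n) ≡ f n) → Quasi m 1 f
    quasi-periodic eq n = ℤ.i≡j⇒i-j≡0 (eq n)

  diff : List ℕ → PowerSeries → PowerSeries
  diff []       f = f
  diff (d ∷ ds) f = diff ds (f ⊕ -1ℤ ⊙ shift (suc d) f)

  extend-diff : ∀ ds p f → extend ds p · f ≗ p · diff ds f
  extend-diff []       p f n = refl
  extend-diff (d ∷ ds) p f n = begin
    (extend (d ∷ ds) p · f) n
      ≡⟨ *ₚ-· (1-X^ suc d) (extend ds p) f n ⟩
    ((1-X^ suc d) · q · f) n                                        ≡⟨ 1-X^-· d (q · f) n ⟩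
    (q · f) n + -1ℤ * shift (suc d) (q · f) n
      ≡⟨ cong (λ x → (q · f) n + -1ℤ * x) (·-shift q (suc d) f n) ⟨
    (q · f) n + -1ℤ * (q · shift (suc d) f) n
      ≡⟨ cong (_+_ ((q · f) n)) (·-⊙ q -1ℤ (shift (suc d) f) n) ⟨
    (q · f) n + (q · -1ℤ ⊙ shift (suc d) f) n
      ≡⟨ ·-⊕ q f (-1ℤ ⊙ shift (suc d) f) n ⟨
    (q · (f ⊕ -1ℤ ⊙ shift (suc d) f)) n
      ≡⟨ extend-diff ds p (f ⊕ -1ℤ ⊙ shift (suc d) f) n ⟩
    (p · diff (d ∷ ds) f) n                                         ∎
    where q = extend ds p

  -- From index `suc m + b` on, multiplication by 1 - x^(suc m) acts as the difference operator on
  -- the sequence starting at `b`. The offset thus grows by `suc m` with each of the k factors,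
  -- after which only zeros remain.
  diff-quasi : ∀ {m} k b f → Quasi (suc m) k (λ n → f (b ℕ.+ n)) →
               ∀ n → k ℕ.* suc m ℕ.+ b ≤ n → diff (replicate k m) f n ≡ + 0
  diff-quasi     zero    b f q n b≤n with j , refl ← ℕ.m≤n⇒∃[o]m+o≡n b≤n = q j
  diff-quasi {m} (suc k) b f q n le =
    diff-quasi k (suc m ℕ.+ b) (f ⊕ -1ℤ ⊙ shift (suc m) f)
      (quasi-cong (suc m) k step q) n (ℕ.≤-trans (ℕ.≤-reflexive rearrange) le)
    where
    rearrange : k ℕ.* suc m ℕ.+ (suc m ℕ.+ b) ≡ suc k ℕ.* suc m ℕ.+ b
    rearrange = trans (sym (ℕ.+-assoc (k ℕ.* suc m) (suc m) b))
                      (cong (ℕ._+ b) (ℕ.+-comm (k ℕ.* suc m) (suc m)))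

    step : ∀ j → f (b ℕ.+ (suc m ℕ.+ j)) - f (b ℕ.+ j) ≡
           f (suc m ℕ.+ b ℕ.+ j) + -1ℤ * shift (suc m) f (suc m ℕ.+ b ℕ.+ j)
    step j = cong₂ _+_
      (cong f (trans (sym (ℕ.+-assoc b (suc m) j)) (cong (ℕ._+ j) (ℕ.+-comm b (suc m)))))
      (trans (sym (ℤ.-1*i≡-i (f (b ℕ.+ j)))) (cong (-1ℤ *_) (sym (trans
        (cong (shift (suc m) f) (ℕ.+-assoc (suc m) b j)) (shift-+ (suc m) f (b ℕ.+ j))))))

  toPowerSeries-applyUpTo : ∀ B (f : PowerSeries) → (∀ n → B ≤ n → f n ≡ + 0) →
                            toPowerSeries (applyUpTo f B) ≗ f
  toPowerSeries-applyUpTo zero    f eq n       = sym (eq n z≤n)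
  toPowerSeries-applyUpTo (suc B) f eq zero    = refl
  toPowerSeries-applyUpTo (suc B) f eq (suc n) =
    toPowerSeries-applyUpTo B (f ∘ suc) (λ m B≤m → eq (suc m) (s≤s B≤m)) n

  module _ (D : Polynomial ℤ) (B : ℕ) where

    head : PowerSeries → Polynomial ℤ
    head f = applyUpTo (D · f) B

    -- Reduces an identity of series to one of polynomials: (1 - x^(suc m))^k f is a polynomial, so
    -- the claim that `D · f` stops after `B` coefficients can be checked by evaluation once both
    -- sides are multiplied by that power.
    ·-quasi : ∀ m k {f} → Quasi (suc m) k f →
      (D *ₚ applyUpTo (diff (replicate k m) f) (k ℕ.* suc m) ≈ᵇ extend (replicate k m) (head f)) ≡ true →
      D · f ≗ toPowerSeries (head f)
    ·-quasi m k {f} q check = extend-injective (replicate k m) D (head f) λ n → begin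
      (extend (replicate k m) D · f) n                     ≡⟨ extend-diff (replicate k m) D f n ⟩
      (D · diff (replicate k m) f) n
        ≡⟨ ·-cong D (toPowerSeries-applyUpTo (k ℕ.* suc m) _ (λ j le →
             diff-quasi k 0 f q j (subst (_≤ j) (sym (ℕ.+-identityʳ _)) le))) n ⟨
      (D · toPowerSeries (applyUpTo (diff (replicate k m) f) (k ℕ.* suc m))) n
        ≡⟨ toPowerSeries-* D _ n ⟨
      toPowerSeries (D *ₚ applyUpTo (diff (replicate k m) f) (k ℕ.* suc m)) n
        ≡⟨ ≈ᵇ-sound (D *ₚ applyUpTo (diff (replicate k m) f) (k ℕ.* suc m)) (extend (replicate k m) (head f)) check n ⟩
      toPowerSeries (extend (replicate k m) (head f)) n    ∎

open Quasi

-- Embedding integers into the rationals, and residues.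

module Rationals where

  open import Data.Fin.Properties using (toℕ-fromℕ<; toℕ-injective)
  open import Data.Integer.Tactic.RingSolver using (solve-∀)
  open import Data.Rational.Base using (_+_; _*_; ↥_)
  open import Data.Rational.Unnormalised.Base using (*≡*)
  import Data.Rational.Unnormalised.Properties as ℚᵘ

  fromℤ-+ : ∀ i j → fromℤ (i ℤ.+ j) ≡ fromℤ i + fromℤ j
  fromℤ-+ i j = ℚ.toℚᵘ-injective (ℚᵘ.≃-trans (*≡* (lemma i j))
    (ℚᵘ.≃-sym (ℚ.toℚᵘ-homo-+ (fromℤ i) (fromℤ j))))
    where
    lemma : ∀ i j → (i ℤ.+ j) ℤ.* + 1 ≡ (i ℤ.* + 1 ℤ.+ j ℤ.* + 1) ℤ.* + 1
    lemma = solve-∀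

  fromℤ-* : ∀ i j → fromℤ (i ℤ.* j) ≡ fromℤ i * fromℤ j
  fromℤ-* i j = ℚ.toℚᵘ-injective (ℚᵘ.≃-trans (*≡* refl)
    (ℚᵘ.≃-sym (ℚ.toℚᵘ-homo-* (fromℤ i) (fromℤ j))))

  toℚ-+ : ∀ m n → toℚ (m ℕ.+ n) ≡ toℚ m + toℚ n
  toℚ-+ m n = fromℤ-+ (+ m) (+ n)

  fromℤ-injective : ∀ {i j} → fromℤ i ≡ fromℤ j → i ≡ j
  fromℤ-injective = cong ↥_

  toℕ-mod : ∀ m n .{{_ : NonZero n}} → toℕ (m mod n) ≡ m % n
  toℕ-mod m n = toℕ-fromℕ< (m%n<n m n)

  mod-cong : ∀ {l m} n .{{_ : NonZero n}} → l % n ≡ m % n → l mod n ≡ m mod n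
  mod-cong {l} {m} n eq = toℕ-injective (trans (toℕ-mod l n) (trans eq (sym (toℕ-mod m n))))

open Rationals

-- Periodicity and integrality of the coefficient functions.

module Coefficients where

  open import Data.List.Membership.DecPropositional ℕ._≟_ using (_∈?_)
  open import Data.Nat.Base using (_/_)
  open import Data.Rational.Base using (_*_; ↥_)

  module _ {A : Set} where

    Periodic : ℕ → (ℕ → A) → Set
    Periodic m f = ∀ t → f (m ℕ.+ t) ≡ f t

    periodic-* : ∀ {m f} k → Periodic m f → Periodic (k ℕ.* m) f
    periodic-*         zero    per t = refl
    periodic-* {m} {f} (suc k) per t =
      trans (cong f (ℕ.+-assoc m (k ℕ.* m) t)) (trans (per (k ℕ.* m ℕ.+ t)) (periodic-* {m} {f} k per t))

    periodic-% : ∀ {m f} .{{_ : NonZero m}} → Periodic m f → ∀ t → f t ≡ f (t % m)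
    periodic-% {m} {f} per t = trans
      (cong f (trans (m≡m%n+[m/n]*n t m) (ℕ.+-comm (t % m) _)))
      (periodic-* {m} {f} (t / m) per (t % m))

  mod-periodic : ∀ n .{{_ : NonZero n}} → Periodic n (_mod n)
  mod-periodic n t = mod-cong n (trans (cong (_% n) (ℕ.+-comm n t)) ([m+n]%n≡m%n t n))

  -- The tables of Defs, recovered from their values.

  a₂-lookup : ∀ t → a₂ t ≡ lookup (tabulate {n = 6} (λ i → a₂ (toℕ i))) (t mod 6)
  a₂-lookup t = refl

  a₁-lookup : ∀ t → a₁ t ≡ lookup (tabulate {n = 12} (λ i → a₁ (toℕ i))) (t mod 12)
  a₁-lookup t = refl

  a₀-lookup : ∀ t → a₀ t ≡ lookup (lookup
    (tabulate {n = 20} (λ i → tabulate {n = 6} (λ j → a₀ (toℕ i ℕ.+ toℕ j ℕ.* 20)))) (t mod 20))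
    ((t / 20) mod 6)
  a₀-lookup t = refl

  a₂-periodic : Periodic 6 a₂
  a₂-periodic t = trans (a₂-lookup (6 ℕ.+ t)) (trans
    (cong (lookup (tabulate (λ i → a₂ (toℕ i)))) (mod-periodic 6 t))
    (sym (a₂-lookup t)))

  a₁-periodic : Periodic 12 a₁
  a₁-periodic t = trans (a₁-lookup (12 ℕ.+ t)) (trans
    (cong (lookup (tabulate (λ i → a₁ (toℕ i)))) (mod-periodic 12 t))
    (sym (a₁-lookup t)))

  a₀-periodic : Periodic 120 a₀
  a₀-periodic t = trans (a₀-lookup (120 ℕ.+ t)) (trans
    (cong₂ (λ i j → lookup (lookup (tabulate λ i → tabulate λ j → a₀ (toℕ i ℕ.+ toℕ j ℕ.* 20)) i) j)
      (periodic-* {m = 20} {f = _mod 20} 6 (mod-periodic 20) t)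
      (trans (cong (_mod 6) (+-distrib-/-∣ˡ {120} t {20} (divides 6 refl))) (mod-periodic 6 (t / 20))))
    (sym (a₀-lookup t)))

  ε-periodic : Periodic 21 ε
  ε-periodic t = cong (λ r → if does (r ∈? 10 ∷ 13 ∷ 16 ∷ 17 ∷ 19 ∷ 20 ∷ []) then 1 else 0)
    (trans (cong (_% 21) (ℕ.+-comm 21 t)) ([m+n]%n≡m%n t 21))

  -- Positivity matters: truncated subtraction gives `S₇ 0` and `S₇ 21` the same value 0.
  S₇-21+ : ∀ t → 1 ≤ t → S₇ (21 ℕ.+ t) ≡ suc (S₇ t)
  S₇-21+ (suc t) _ = cong₂ ℕ._+_
    (trans (cong (_/ 21) (ℕ.+-suc 20 t)) (+-distrib-/-∣ˡ {21} t {21} (divides 1 refl)))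
    (ε-periodic (suc t))

  -- 40 is a common denominator of the coefficients.
  scaled : (ℕ → ℚ) → ℕ → ℤ
  scaled a t = ↥ (toℚ 40 * a t)

  scaled-periodic : ∀ {m a} → Periodic m a → Periodic m (scaled a)
  scaled-periodic per t = cong (λ q → ↥ (toℚ 40 * q)) (per t)

  -- `scaled` keeps only a numerator, so the claim is that 40 times the coefficient is an integer.
  -- Periodicity leaves one period to evaluate.
  scaled-sound : ∀ {m a} .{{_ : NonZero m}} → Periodic m a →
                 (∀ {r} → r < m → fromℤ (scaled a r) ≡ toℚ 40 * a r) →
                 ∀ t → fromℤ (scaled a t) ≡ toℚ 40 * a t
  scaled-sound {m} {a} per check t = begin
    fromℤ (scaled a t)       ≡⟨ cong (λ q → fromℤ (↥ (toℚ 40 * q))) (periodic-% {f = a} per t) ⟩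
    fromℤ (scaled a (t % m)) ≡⟨ check (m%n<n t m) ⟩
    toℚ 40 * a (t % m)       ≡⟨ cong (toℚ 40 *_) (periodic-% {f = a} per t) ⟨
    toℚ 40 * a t             ∎
    where open ≡-Reasoning

  private
    integral? = λ a r → fromℤ (scaled a r) ℚ.≟ toℚ 40 * a r

  a₂-scaled : ∀ t → fromℤ (scaled a₂ t) ≡ toℚ 40 * a₂ t
  a₂-scaled = scaled-sound {a = a₂} a₂-periodic (from-yes (ℕ.allUpTo? (integral? a₂) 6))

  a₁-scaled : ∀ t → fromℤ (scaled a₁ t) ≡ toℚ 40 * a₁ t
  a₁-scaled = scaled-sound {a = a₁} a₁-periodic (from-yes (ℕ.allUpTo? (integral? a₁) 12))

  a₀-scaled : ∀ t → fromℤ (scaled a₀ t) ≡ toℚ 40 * a₀ t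
  a₀-scaled = scaled-sound {a = a₀} a₀-periodic (from-yes (ℕ.allUpTo? (integral? a₀) 120))

open Coefficients

-- The closed formula and the count have the same generating function.

module Formula where

  open import Data.Integer.Base using (_+_; _*_; _-_)
  open import Data.Integer.Tactic.RingSolver using (solve-∀)

  open ≡-Reasoning

  -- S₇ 0 is a truncated value; the shift in floor replaces it by -1, which
  -- continues the values at positive arguments.
  affine quartic quadratic linear constant floor : PowerSeries
  affine n  = + 5 * + n - + 120
  quartic   = id⊙ id⊙ id⊙ affine
  quadratic = id⊙ id⊙ scaled a₂
  linear    = id⊙ scaled a₁
  constant  = scaled a₀
  floor n   = + S₇ (21 ℕ.+ n) - + 1

  -- `affine` is 40 (n/8 - 3), so `quartic` is 40 times the two leading terms. It is a genuine
  -- polynomial of degree 4, whence modulus 1 and five differences.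
  quartic-quasi : Quasi 1 5 quartic
  quartic-quasi = quasi-id⊙ 1 4 (id⊙ id⊙ affine)
    (quasi-id⊙ 1 3 (id⊙ affine) (quasi-id⊙ 1 2 affine λ n → lemma (+ n)))
    where
    lemma : ∀ n → (+ 5 * (+ 1 + (+ 1 + n)) - + 120) - (+ 5 * (+ 1 + n) - + 120)
                - ((+ 5 * (+ 1 + n) - + 120) - (+ 5 * n - + 120)) ≡ + 0
    lemma = solve-∀

  quadratic-quasi : Quasi 6 3 quadratic
  quadratic-quasi = quasi-id⊙ 6 2 (id⊙ scaled a₂) (quasi-id⊙ 6 1 (scaled a₂)
    (quasi-periodic 6 {f = scaled a₂} (scaled-periodic {6} {a₂} a₂-periodic)))

  linear-quasi : Quasi 12 2 linear
  linear-quasi = quasi-id⊙ 12 1 (scaled a₁)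
    (quasi-periodic 12 {f = scaled a₁} (scaled-periodic {12} {a₁} a₁-periodic))

  constant-quasi : Quasi 120 1 constant
  constant-quasi = quasi-periodic 120 {f = constant} (scaled-periodic {120} {a₀} a₀-periodic)

  floor-quasi : Quasi 21 2 floor
  floor-quasi n = begin
    ∇ 21 floor (21 ℕ.+ n) - ∇ 21 floor n                   ≡⟨ cong₂ _-_ (step (21 ℕ.+ n)) (step n) ⟩
    + 1 - + 1                                              ≡⟨⟩
    + 0                                                    ∎
    where
    lemma : ∀ x → (+ 1 + x - + 1) - (x - + 1) ≡ + 1
    lemma = solve-∀

    step : ∀ n → ∇ 21 floor n ≡ + 1
    step n = trans (cong (λ s → + s - + 1 - floor n) (S₇-21+ (21 ℕ.+ n) (s≤s z≤n)))
                   (lemma (+ S₇ (21 ℕ.+ n)))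

  floor-≥1 : ∀ n → 1 ≤ n → floor n ≡ + S₇ n
  floor-≥1 n 1≤n = trans (cong (λ s → + s - + 1) (S₇-21+ n 1≤n)) (lemma (+ S₇ n))
    where
    lemma : ∀ x → + 1 + x - + 1 ≡ x
    lemma = solve-∀

  record Image (f : PowerSeries) (p : Polynomial ℤ) : Set where
    constructor image
    field eq : denominator · f ≗ toPowerSeries p

  -- Every component is a proper fraction over the denominator, of degree 34.
  private
    H : PowerSeries → Polynomial ℤ
    H = head denominator 34

    infixr 7 _⊙ₚ_
    _⊙ₚ_ : ℤ → Polynomial ℤ → Polynomial ℤ
    c ⊙ₚ p = List.map (c *_) p

  -- In this and the next four images the modulus is passed as its predecessor: 0, 5, 11, 119, 20
  -- stand for 1, 6, 12, 120, 21.
  quartic-image : Image quartic (H quartic)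
  quartic-image = image (·-quasi denominator 34 0 5 {quartic} quartic-quasi refl)

  quadratic-image : Image quadratic (H quadratic)
  quadratic-image = image (·-quasi denominator 34 5 3 {quadratic} quadratic-quasi refl)

  linear-image : Image linear (H linear)
  linear-image = image (·-quasi denominator 34 11 2 {linear} linear-quasi refl)

  constant-image : Image constant (H constant)
  constant-image = image (·-quasi denominator 34 119 1 {constant} constant-quasi refl)

  floor-image : Image floor (H floor)
  floor-image = image (·-quasi denominator 34 20 2 {floor} floor-quasi refl)

  count-image : Image count numerator
  count-image = image denominator-·-count

  δ-image : Image δ denominator
  δ-image = image (·-δ denominator)

  -- 40 times the closed formula.
  formula : PowerSeries
  formula = quartic ⊕ quadratic ⊕ -1ℤ ⊙ linear ⊕ constant ⊕ (-[1+ 2879 ]) ⊙ floor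

  image-⊕ : ∀ {f g p q} → Image f p → Image g q → Image (f ⊕ g) (p +ₚ q)
  image-⊕ {f} {g} {p} {q} (image e) (image e′) = image λ n →
    trans (·-⊕ denominator f g n) (trans (cong₂ _+_ (e n) (e′ n)) (sym (toPowerSeries-+ p q n)))

  image-⊙ : ∀ c {f p} → Image f p → Image (c ⊙ f) (c ⊙ₚ p)
  image-⊙ c {f} {p} (image e) = image λ n →
    trans (·-⊙ denominator c f n) (trans (cong (c *_) (e n)) (sym (toPowerSeries-map c p n)))

  -- The factor -2880 of `floor` is -(40 · 72).
  formula-image : Image formula
    (H quartic +ₚ H quadratic +ₚ -1ℤ ⊙ₚ H linear +ₚ H constant +ₚ (-[1+ 2879 ]) ⊙ₚ H floor)
  formula-image = image-⊕ (image-⊕ (image-⊕ (image-⊕ quartic-image quadratic-image)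
    (image-⊙ -1ℤ linear-image)) constant-image) (image-⊙ (-[1+ 2879 ]) floor-image)

  -- The formula, unlike the series, does not vanish at 0: 37920 = 40 · 948.
  corrected-count-image : Image (+ 40 ⊙ count ⊕ + 37920 ⊙ δ) (+ 40 ⊙ₚ numerator +ₚ + 37920 ⊙ₚ denominator)
  corrected-count-image = image-⊕ (image-⊙ (+ 40) count-image) (image-⊙ (+ 37920) δ-image)

  -- `denominator` has constant term 1 and can be cancelled, so comparing two numerators decides the
  -- equality of the series.
  image-unique : ∀ {f g p q} → Image f p → Image g q → (p ≈ᵇ q) ≡ true → f ≗ g
  image-unique {f} {g} {p} {q} (image e) (image e′) eq = ·-cancel denominator {f} {g} refl λ n →
    trans (e n) (trans (≈ᵇ-sound p q eq n) (sym (e′ n)))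

  count-formula : + 40 ⊙ count ⊕ + 37920 ⊙ δ ≗ formula
  count-formula = image-unique corrected-count-image formula-image refl

open Formula

-- Polynomials agreeing at infinitely many points.

module RootBound where

  open import Data.Rational.Base using (_+_; _*_; _-_; -_; 0ℚ; 1ℚ; 1/_; ≢-nonZero)
  open import Data.Rational.Solver using (module +-*-Solver)

  open ≡-Reasoning
  open +-*-Solver using (solve; _:=_; _:+_; _:*_; _:-_; con)

  infixl 6 _⊞_

  _⊞_ : Polynomial ℚ → Polynomial ℚ → Polynomial ℚ
  []      ⊞ q       = q
  (a ∷ p) ⊞ []      = a ∷ p
  (a ∷ p) ⊞ (b ∷ q) = a + b ∷ p ⊞ q

  eval-⊞ : ∀ p q x → eval (p ⊞ q) x ≡ eval p x + eval q x
  eval-⊞ []      q       x = sym (ℚ.+-identityˡ _)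
  eval-⊞ (a ∷ p) []      x = sym (ℚ.+-identityʳ _)
  eval-⊞ (a ∷ p) (b ∷ q) x = trans (cong (λ y → a + b + x * y) (eval-⊞ p q x))
    (solve 5 (λ a b x y z → a :+ b :+ x :* (y :+ z) := (a :+ x :* y) :+ (b :+ x :* z)) refl
      a b x (eval p x) (eval q x))

  eval-map : ∀ c p x → eval (List.map (c *_) p) x ≡ c * eval p x
  eval-map c []      x = sym (ℚ.*-zeroʳ c)
  eval-map c (a ∷ p) x = trans (cong (λ y → c * a + x * y) (eval-map c p x))
    (solve 4 (λ c a x y → c :* a :+ x :* (c :* y) := c :* (a :+ x :* y)) refl c a x (eval p x))

  length-⊞ : ∀ p q {n} → length p ≤ n → length q ≤ n → length (p ⊞ q) ≤ n
  length-⊞ []      q       _         q≤n       = q≤n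
  length-⊞ (a ∷ p) []      p≤n       _         = p≤n
  length-⊞ (a ∷ p) (b ∷ q) (s≤s p≤n) (s≤s q≤n) = s≤s (length-⊞ p q p≤n q≤n)

  -- (p(x) - p(a)) / (x - a)
  quotient : Polynomial ℚ → ℚ → Polynomial ℚ
  quotient []      a = []
  quotient (c ∷ p) a = p ⊞ List.map (a *_) (quotient p a)

  eval-quotient : ∀ p a x → eval p x ≡ eval p a + (x - a) * eval (quotient p a) x
  eval-quotient []      a x = sym (trans (ℚ.+-identityˡ _) (ℚ.*-zeroʳ (x - a)))
  eval-quotient (c ∷ p) a x = begin
    c + x * eval p x
      ≡⟨ solve 5 (λ c x a y z → c :+ x :* y := c :+ a :* z :+ ((x :- a) :* y :+ a :* (y :- z))) refl
           c x a (eval p x) (eval p a) ⟩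
    c + a * eval p a + ((x - a) * eval p x + a * (eval p x - eval p a))
      ≡⟨ cong (λ y → c + a * eval p a + ((x - a) * eval p x + a * (y - eval p a))) (eval-quotient p a x) ⟩
    c + a * eval p a + ((x - a) * eval p x + a * (eval p a + (x - a) * eval (quotient p a) x - eval p a))
      ≡⟨ solve 6 (λ c x a y z w → c :+ a :* z :+ ((x :- a) :* y :+ a :* (z :+ (x :- a) :* w :- z))
                               := c :+ a :* z :+ (x :- a) :* (y :+ a :* w)) refl
           c x a (eval p x) (eval p a) (eval (quotient p a) x) ⟩
    c + a * eval p a + (x - a) * (eval p x + a * eval (quotient p a) x)
      ≡⟨ cong (λ y → c + a * eval p a + (x - a) * y) (begin
           eval p x + a * eval (quotient p a) x
             ≡⟨ cong (_+_ (eval p x)) (eval-map a (quotient p a) x) ⟨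
           eval p x + eval (List.map (a *_) (quotient p a)) x      ≡⟨ eval-⊞ p _ x ⟨
           eval (quotient (c ∷ p) a) x                             ∎) ⟩
    eval (c ∷ p) a + (x - a) * eval (quotient (c ∷ p) a) x ∎

  length-quotient : ∀ p a {n} → length p ≤ suc n → length (quotient p a) ≤ n
  length-quotient []          a _         = z≤n
  length-quotient (c ∷ [])    a _         = z≤n
  length-quotient (c ∷ p@(_ ∷ _)) a {suc n} (s≤s p≤n) = length-⊞ p (List.map (a *_) (quotient p a)) p≤n
    (ℕ.≤-trans (ℕ.≤-reflexive (List.length-map (a *_) (quotient p a)))
      (ℕ.m≤n⇒m≤1+n (length-quotient p a p≤n)))

  x*y≡0⇒y≡0 : ∀ {x y} → x ≢ 0ℚ → x * y ≡ 0ℚ → y ≡ 0ℚ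
  x*y≡0⇒y≡0 {x} {y} x≢0 xy≡0 = begin
    y                 ≡⟨ ℚ.*-identityˡ y ⟨
    1ℚ * y            ≡⟨ cong (_* y) (ℚ.*-inverseˡ x) ⟨
    1/ x * x * y      ≡⟨ ℚ.*-assoc (1/ x) x y ⟩
    1/ x * (x * y)    ≡⟨ cong (1/ x *_) xy≡0 ⟩
    1/ x * 0ℚ         ≡⟨ ℚ.*-zeroʳ (1/ x) ⟩
    0ℚ                ∎
    where instance _ = ≢-nonZero x≢0

  x-y≡0⇒x≡y : ∀ x y → x - y ≡ 0ℚ → x ≡ y
  x-y≡0⇒x≡y x y eq = begin
    x           ≡⟨ solve 2 (λ x y → x := (x :- y) :+ y) refl x y ⟩
    (x - y) + y ≡⟨ cong (_+ y) eq ⟩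
    0ℚ + y      ≡⟨ ℚ.+-identityˡ y ⟩
    y           ∎

  -- Splitting off x - `s 0` shortens the polynomial, and the remaining `s k` differ from `s 0`, so
  -- they are roots of the quotient. The infinite sequence supplies a fresh root at every stage.
  eval-vanishes : ∀ n p → length p ≤ n → (s : ℕ → ℚ) → (∀ {i j} → s i ≡ s j → i ≡ j) →
                  (∀ k → eval p (s k) ≡ 0ℚ) → ∀ x → eval p x ≡ 0ℚ
  eval-vanishes zero    []  _   s s-inj root x = refl
  eval-vanishes (suc n) p p≤n s s-inj root x = begin
    eval p x                                        ≡⟨ factor x ⟩
    (x - s 0) * eval q x
      ≡⟨ cong ((x - s 0) *_) (eval-vanishes n q (length-quotient p (s 0) p≤n)
                                                         (s ∘ suc) (ℕ.suc-injective ∘ s-inj) root′ x) ⟩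
    (x - s 0) * 0ℚ                                  ≡⟨ ℚ.*-zeroʳ (x - s 0) ⟩
    0ℚ                                              ∎
    where
    q = quotient p (s 0)

    factor : ∀ x → eval p x ≡ (x - s 0) * eval q x
    factor x = trans (eval-quotient p (s 0) x) (trans (cong (_+ (x - s 0) * eval q x) (root 0))
      (ℚ.+-identityˡ _))

    distinct : ∀ k → s (suc k) - s 0 ≢ 0ℚ
    distinct k eq = ℕ.1+n≢0 (s-inj (x-y≡0⇒x≡y (s (suc k)) (s 0) eq))

    root′ : ∀ k → eval q (s (suc k)) ≡ 0ℚ
    root′ k = x*y≡0⇒y≡0 (distinct k) (trans (sym (factor (s (suc k)))) (root (suc k)))

  eval-unique : ∀ p q (s : ℕ → ℚ) → (∀ {i j} → s i ≡ s j → i ≡ j) →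
                (∀ k → eval p (s k) ≡ eval q (s k)) → eval p ≗ eval q
  eval-unique p q s s-inj agree x = begin
    eval p x
      ≡⟨ solve 2 (λ y z → y := (y :+ con (- 1ℚ) :* z) :+ z) refl (eval p x) (eval q x) ⟩
    (eval p x + - 1ℚ * eval q x) + eval q x ≡⟨ cong (_+ eval q x) (difference x) ⟨
    eval d x + eval q x
      ≡⟨ cong (_+ eval q x) (eval-vanishes (length d) d ℕ.≤-refl s s-inj root x) ⟩
    0ℚ + eval q x                           ≡⟨ ℚ.+-identityˡ _ ⟩
    eval q x                                ∎
    where
    d = p ⊞ List.map (- 1ℚ *_) q

    difference : ∀ x → eval d x ≡ eval p x + - 1ℚ * eval q x
    difference x = trans (eval-⊞ p _ x) (cong (_+_ (eval p x)) (eval-map (- 1ℚ) q x))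

    root : ∀ k → eval d (s k) ≡ 0ℚ
    root k = trans (difference (s k)) (trans (cong (_+ - 1ℚ * eval q (s k)) (agree k))
      (solve 1 (λ y → y :+ con (- 1ℚ) :* y := con 0ℚ) refl (eval q (s k))))

open RootBound

-- The formula over the rationals, the constituents and the period.

module Constituents where

  open import Data.Nat.Tactic.RingSolver using (solve-∀)
  open import Data.Rational.Base
    using (_/_; _+_; _*_; _-_; -_; 0ℚ; 1ℚ; +-*-rawSemiring)
  open import Algebra.Definitions.RawSemiring +-*-rawSemiring using (_^_)
  open import Data.Rational.Solver using (module +-*-Solver)

  open ≡-Reasoning
  open +-*-Solver using (solve; _:=_; _:+_; _:*_; _:-_; con)

  fromℤ-formula : ∀ t → 1 ≤ t → fromℤ (formula t) ≡
      toℚ t * (toℚ t * (toℚ t * (toℚ 5 * toℚ t + fromℤ -[1+ 119 ])))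
    + toℚ t * (toℚ t * (toℚ 40 * a₂ t))
    + fromℤ ℤ.-1ℤ * (toℚ t * (toℚ 40 * a₁ t))
    + toℚ 40 * a₀ t
    + fromℤ -[1+ 2879 ] * toℚ (S₇ t)
  fromℤ-formula t 1≤t =
    +⟨ quartic t ℤ.+ quadratic t ℤ.+ ℤ.-1ℤ ℤ.* linear t ℤ.+ constant t , -[1+ 2879 ] ℤ.* floor t ⟩
    (+⟨ quartic t ℤ.+ quadratic t ℤ.+ ℤ.-1ℤ ℤ.* linear t , constant t ⟩
    (+⟨ quartic t ℤ.+ quadratic t , ℤ.-1ℤ ℤ.* linear t ⟩
    (+⟨ quartic t , quadratic t ⟩
      (id⟨ id⊙ id⊙ affine ⟩ id⟨ id⊙ affine ⟩ id⟨ affine ⟩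
        +⟨ + 5 ℤ.* + t , -[1+ 119 ] ⟩ (fromℤ-* (+ 5) (+ t)) refl)
      (id⟨ id⊙ scaled a₂ ⟩ id⟨ scaled a₂ ⟩ a₂-scaled t))
      (trans (fromℤ-* ℤ.-1ℤ (linear t)) (cong (fromℤ ℤ.-1ℤ *_) (id⟨ scaled a₁ ⟩ a₁-scaled t))))
      (a₀-scaled t))
      (trans (fromℤ-* -[1+ 2879 ] (floor t)) (cong (λ s → fromℤ -[1+ 2879 ] * fromℤ s) (floor-≥1 t 1≤t)))
    where
    infixr 1 id⟨_⟩_
    id⟨_⟩_ : ∀ f {p} → fromℤ (f t) ≡ p → fromℤ ((id⊙ f) t) ≡ toℚ t * p
    id⟨ f ⟩ e = trans (fromℤ-* (+ t) (f t)) (cong (toℚ t *_) e)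

    +⟨_,_⟩ : ∀ i j {p q} → fromℤ i ≡ p → fromℤ j ≡ q → fromℤ (i ℤ.+ j) ≡ p + q
    +⟨ i , j ⟩ e e′ = trans (fromℤ-+ i j) (cong₂ _+_ e e′)

  Lₐ-formula : ∀ t → 1 ≤ t → toℚ (Lₐ t) ≡
    (+ 1 / 8) * toℚ t ^ 4 - toℚ 3 * toℚ t ^ 3 + a₂ t * toℚ t ^ 2 - a₁ t * toℚ t + a₀ t
      - toℚ 72 * toℚ (S₇ t)
  Lₐ-formula t@(suc _) 1≤t = begin
    toℚ (Lₐ t)
      ≡⟨ solve 1 (λ l → l := con (+ 1 / 40) :* (con (toℚ 40) :* l)) refl (toℚ (Lₐ t)) ⟩
    (+ 1 / 40) * (toℚ 40 * toℚ (Lₐ t))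
      ≡⟨ cong ((+ 1 / 40) *_) (fromℤ-* (+ 40) (+ Lₐ t)) ⟨
    (+ 1 / 40) * fromℤ (+ 40 ℤ.* + Lₐ t)
      -- The correction at 0 disappears: `t` is a successor, so `δ t` is 0.
      ≡⟨ cong (λ i → (+ 1 / 40) * fromℤ i) (trans (sym (ℤ.+-identityʳ (+ 40 ℤ.* + Lₐ t))) (count-formula t)) ⟩
    (+ 1 / 40) * fromℤ (formula t)                ≡⟨ cong ((+ 1 / 40) *_) (fromℤ-formula t 1≤t) ⟩
    _                                             ≡⟨ solve 5 (λ x a₂ a₁ a₀ s →
      con (+ 1 / 40) :* ( x :* (x :* (x :* (con (toℚ 5) :* x :+ con (fromℤ -[1+ 119 ]))))
                       :+ x :* (x :* (con (toℚ 40) :* a₂))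
                       :+ con (fromℤ ℤ.-1ℤ) :* (x :* (con (toℚ 40) :* a₁))
                       :+ con (toℚ 40) :* a₀
                       :+ con (fromℤ -[1+ 2879 ]) :* s)
      := con (+ 1 / 8) :* (x :* (x :* (x :* (x :* con 1ℚ)))) :- con (toℚ 3) :* (x :* (x :* (x :* con 1ℚ)))
         :+ a₂ :* (x :* (x :* con 1ℚ)) :- a₁ :* x :+ a₀ :- con (toℚ 72) :* s)
      refl (toℚ t) (a₂ t) (a₁ t) (a₀ t) (toℚ (S₇ t)) ⟩
    _ ∎

  -- The part of S₇ t not proportional to t.
  σ : ℕ → ℚ
  σ t = toℚ (S₇ (21 ℕ.+ t)) - 1ℚ - toℚ t * (+ 1 / 21)

  -- When t grows by 21, `S₇` grows by 1, as does the subtracted t/21.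
  σ-periodic : Periodic 21 σ
  σ-periodic t = trans
    (cong₂ (λ s x → s - 1ℚ - x * (+ 1 / 21))
      (trans (cong toℚ (S₇-21+ (21 ℕ.+ t) (s≤s z≤n))) (toℚ-+ 1 (S₇ (21 ℕ.+ t)))) (toℚ-+ 21 t))
    (solve 2 (λ s x → con 1ℚ :+ s :- con 1ℚ :- (con (toℚ 21) :+ x) :* con (+ 1 / 21)
                   := s :- con 1ℚ :- x :* con (+ 1 / 21))
      refl (toℚ (S₇ (21 ℕ.+ t))) (toℚ t))

  S₇-σ : ∀ t → 1 ≤ t → toℚ (S₇ t) ≡ σ t + toℚ t * (+ 1 / 21)
  S₇-σ t 1≤t = begin
    toℚ (S₇ t)
      ≡⟨ solve 2 (λ s x → s := con 1ℚ :+ s :- con 1ℚ :- x :* con (+ 1 / 21) :+ x :* con (+ 1 / 21)) refl (toℚ (S₇ t)) (toℚ t) ⟩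
    1ℚ + toℚ (S₇ t) - 1ℚ - toℚ t * (+ 1 / 21) + toℚ t * (+ 1 / 21)
      ≡⟨ cong (λ s → s - 1ℚ - toℚ t * (+ 1 / 21) + toℚ t * (+ 1 / 21)) (trans (cong toℚ (S₇-21+ t 1≤t)) (toℚ-+ 1 (S₇ t))) ⟨
    σ t + toℚ t * (+ 1 / 21)                      ∎

  constant-term : ℕ → ℚ
  constant-term t = a₀ t - toℚ 72 * σ t

  -- The slope 1/21 of `S₇` moves 72/21 into the linear coefficient; only the periodic part `σ`
  -- stays in the constant term.
  constituent : ℕ → Polynomial ℚ
  constituent t = constant-term t ∷ - a₁ t - toℚ 72 * (+ 1 / 21) ∷ a₂ t ∷ - toℚ 3 ∷ + 1 / 8 ∷ []

  constituent-periodic : Periodic 840 constituent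
  constituent-periodic t = cong₂
    (λ c (c₁ , c₂) → c ∷ - c₁ - toℚ 72 * (+ 1 / 21) ∷ c₂ ∷ - toℚ 3 ∷ + 1 / 8 ∷ [])
    (cong₂ (λ a s → a - toℚ 72 * s)
      (periodic-* {m = 120} {f = a₀} 7 a₀-periodic t)
      (periodic-* {m = 21} {f = σ} 40 σ-periodic t))
    (cong₂ _,_
      (periodic-* {m = 12} {f = a₁} 70 a₁-periodic t)
      (periodic-* {m = 6} {f = a₂} 140 a₂-periodic t))

  constituent-% : ∀ t → constituent t ≡ constituent (t % 840)
  constituent-% = periodic-% {f = constituent} constituent-periodic

  Lₐ-constituent : ∀ t → 1 ≤ t → toℚ (Lₐ t) ≡ eval (constituent t) (toℚ t)
  Lₐ-constituent t 1≤t = begin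
    toℚ (Lₐ t)   ≡⟨ Lₐ-formula t 1≤t ⟩
    _            ≡⟨ cong (λ s → (+ 1 / 8) * toℚ t ^ 4 - toℚ 3 * toℚ t ^ 3 + a₂ t * toℚ t ^ 2
                               - a₁ t * toℚ t + a₀ t - toℚ 72 * s) (S₇-σ t 1≤t) ⟩
    _            ≡⟨ solve 5 (λ x a₂ a₁ a₀ s →
      con (+ 1 / 8) :* (x :* (x :* (x :* (x :* con 1ℚ)))) :- con (toℚ 3) :* (x :* (x :* (x :* con 1ℚ)))
         :+ a₂ :* (x :* (x :* con 1ℚ)) :- a₁ :* x :+ a₀ :- con (toℚ 72) :* (s :+ x :* con (+ 1 / 21))
      := (a₀ :- con (toℚ 72) :* s) :+ x :* ((con 0ℚ :- a₁ :- con (toℚ 72) :* con (+ 1 / 21))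
         :+ x :* (a₂ :+ x :* (con (- toℚ 3) :+ x :* (con (+ 1 / 8) :+ x :* con 0ℚ)))))
      refl (toℚ t) (a₂ t) (a₁ t) (a₀ t) (σ t) ⟩
    _            ≡⟨ cong (λ c → constant-term t + toℚ t * ((c - toℚ 72 * (+ 1 / 21))
                               + toℚ t * (a₂ t + toℚ t * (- toℚ 3 + toℚ t * ((+ 1 / 8) + toℚ t * 0ℚ)))))
                          (ℚ.+-identityˡ (- a₁ t)) ⟩
    eval (constituent t) (toℚ t) ∎

  constituents : Fin 840 → Polynomial ℚ
  constituents i = constituent (toℕ i)

  areConstituents : AreConstituents (λ t → toℚ (Lₐ t)) 840 constituents
  areConstituents t 1≤t = trans (Lₐ-constituent t 1≤t) (cong (λ p → eval p (toℚ t))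
    (trans (constituent-% t) (cong constituent (sym (toℕ-mod t 840)))))

  isPrincipalConstituent : IsPrincipalConstituent (λ t → toℚ (Lₐ t)) 840 principalConstituent
  -- Evaluation at residue 0: `σ 0` is -1, giving 876 + 72 = 948, and 1296/5 + 72/21 = 9192/35.
  isPrincipalConstituent = constituents , areConstituents , refl

  constant-term-unique : ∀ {r} → r < 840 → constant-term r ≡ constant-term 0 → r ≡ 0
  constant-term-unique = from-yes (ℕ.allUpTo?
    (λ r → (constant-term r ℚ.≟ constant-term 0) →-dec (r ℕ.≟ 0)) 840)

  eval-constituent-0 : ∀ t → eval (constituent t) 0ℚ ≡ constant-term t
  eval-constituent-0 t = lemma (constant-term t) (eval (drop 1 (constituent t)) 0ℚ)
    where
    lemma : ∀ c y → c + 0ℚ * y ≡ c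
    lemma c y = trans (cong (_+_ c) (ℚ.*-zeroˡ y)) (ℚ.+-identityʳ c)

  module Minimality (q : ℕ) .{{_ : NonZero q}} (N : Fin q → Polynomial ℚ)
                    (areN : AreConstituents (λ t → toℚ (Lₐ t)) q N) where

    -- The step 840 q fixes the residues modulo 840 and modulo q at once; `suc k` keeps the terms
    -- positive even for r = 0.
    progression : ℕ → ℕ → ℕ
    progression r k = r ℕ.+ suc k ℕ.* (840 ℕ.* q)

    progression-injective : ∀ r {i j} → toℚ (progression r i) ≡ toℚ (progression r j) → i ≡ j
    progression-injective r eq = ℕ.suc-injective (ℕ.*-cancelʳ-≡ _ _ (840 ℕ.* q) {{ℕ.m*n≢0 840 q}}
      (ℕ.+-cancelˡ-≡ r _ _ (ℤ.+-injective (fromℤ-injective eq))))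

    -- On the progression from `r` both descriptions of `Lₐ` apply, each with a single fixed
    -- polynomial.
    agree : ∀ r → r % q ≡ 0 → eval (N (0 mod q)) ≗ eval (constituent (r % 840))
    agree r r%q≡0 = eval-unique (N (0 mod q)) (constituent (r % 840))
      (toℚ ∘ progression r) (progression-injective r) λ k →
      let t = progression r k
          1≤t : 1 ≤ t
          1≤t = ℕ.≤-trans
            (ℕ.>-nonZero⁻¹ _ {{ℕ.m*n≢0 (suc k) (840 ℕ.* q) {{_}} {{ℕ.m*n≢0 840 q}}}})
            (ℕ.m≤n+m _ r)
          t%q : t % q ≡ 0 % q
          t%q = trans (cong (_% q) (cong (r ℕ.+_) (sym (ℕ.*-assoc (suc k) 840 q))))
            (trans ([m+kn]%n≡m%n r (suc k ℕ.* 840) q) (trans r%q≡0 (sym (m*n%n≡0 0 q))))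
          t%840 : t % 840 ≡ r % 840
          t%840 = trans (cong (_% 840) (cong (r ℕ.+_) (lemma (suc k) q))) ([m+kn]%n≡m%n r (suc k ℕ.* q) 840)
      in begin
      eval (N (0 mod q)) (toℚ t)
        ≡⟨ cong (λ i → eval (N i) (toℚ t)) (mod-cong q t%q) ⟨
      eval (N (t mod q)) (toℚ t)                 ≡⟨ areN t 1≤t ⟨
      toℚ (Lₐ t)                                 ≡⟨ Lₐ-constituent t 1≤t ⟩
      eval (constituent t) (toℚ t)
        ≡⟨ cong (λ p → eval p (toℚ t)) (trans (constituent-% t) (cong constituent t%840)) ⟩
      eval (constituent (r % 840)) (toℚ t)       ∎
      where
      lemma : ∀ k q → k ℕ.* (840 ℕ.* q) ≡ k ℕ.* q ℕ.* 840
      lemma = solve-∀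

    minimal : 840 ≤ q
    -- Taking r = q and r = 0 in `agree` and evaluating at 0 gives equal constant terms at q mod 840
    -- and at 0. Hence q mod 840 is 0, so 840 divides q.
    minimal = ∣⇒≤ (m%n≡0⇒n∣m q 840 (constant-term-unique (m%n<n q 840) (begin
      constant-term (q % 840)             ≡⟨ eval-constituent-0 (q % 840) ⟨
      eval (constituent (q % 840)) 0ℚ     ≡⟨ agree q (n%n≡0 q) 0ℚ ⟨
      eval (N (0 mod q)) 0ℚ               ≡⟨ agree 0 (m*n%n≡0 0 q) 0ℚ ⟩
      eval (constituent 0) 0ℚ             ≡⟨ eval-constituent-0 0 ⟩
      constant-term 0                     ∎)))

  isPeriod : IsPeriod (λ t → toℚ (Lₐ t)) 840
  isPeriod = (constituents , areConstituents) , λ q (N , areN) → Minimality.minimal q N areN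

open Constituents

-- Assembling the claims.

generatingFunction-count : generatingFunction Lₐ ≗ count
-- With sum 0 the list of candidate squares is empty, so `Lₐ 0` evaluates to 0.
generatingFunction-count zero    = refl
generatingFunction-count (suc n) = refl

Lₐ-rational : generatingFunction Lₐ ≈ numerator ÷ denominator
Lₐ-rational = refl , λ n → trans (⊛-· denominator (generatingFunction Lₐ) n)
  (trans (·-cong denominator generatingFunction-count n) (denominator-·-count n))

open import Data.Nat.Base using () renaming (_≤_ to _≤ℕ_)
open import Data.Rational.Base using (_/_; _+_; _-_; _*_; +-*-rawSemiring)
open import Algebra.Definitions.RawSemiring +-*-rawSemiring using (_^_)

mainTheorem6 : (generatingFunction Lₐ ≈ numerator ÷ denominator)
    × (∀ (t : ℕ) → 1 ≤ℕ t →
    toℚ (Lₐ t) ≡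
    (+ 1 / 8) * toℚ t ^ 4 - toℚ 3 * toℚ t ^ 3 + a₂ t * toℚ t ^ 2 - a₁ t * toℚ t + a₀ t
    - toℚ 72 * toℚ (S₇ t))
    × IsPeriod (λ t → toℚ (Lₐ t)) 840
    × IsPrincipalConstituent (λ t → toℚ (Lₐ t)) 840 principalConstituent
mainTheorem6 = Lₐ-rational , Lₐ-formula , isPeriod , isPrincipalConstituent
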